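{- Let $m\ge1$ be an integer, let $\alpha\ge1$, and put $R=\max\{2,\ \alpha,\ 1+\frac2\alpha\}$ and $r=\max\{\alpha,\ 1+\frac1\alpha\}$. If $R\le 2r$, then there is a (deterministic) online algorithm for scheduling with uncertain processing times on $m$ machines, with the objective of minimizing the total completion time, that is $$\left(\max\left\{2,\ \alpha,\ 1+\tfrac2\alpha\right\}\cdot\left(\tfrac12+\tfrac1{2m}\right)+\max\left\{\alpha,\ 1+\tfrac1\alpha\right\}\cdot\left(1-\tfrac1m\right)\right)\text{ -competitive}$$ on all instances in which the testing times of all jobs are uniform (equal to each other).
   Context: Problem. There are $n$ jobs, all available at time $0$, and $m$ identical machines, each of which runs one task at a time. Job $j$ has a testing time $t_j> 0$, an upper limit $u_j\ge 0$, and a real processing time $p_j\in[0,u_j]$. A job may be executed untested, which takes $u_j$ time units, or it may be tested (taking $t_j$ time units) and afterwards, once the test is finished, executed in $p_j$ time units; other tasks may run between the test and the execution, and the test and the execution of a job may be on different machines. The completion time of a job is the time at which its execution (or execution-untested) ends, and the cost of a schedule is the sum of the completion times of all jobs. An online algorithm knows all $t_j,u_j$ from the start, but learns $p_j$ only when the test of $j$ is finished. $\mathrm{OPT}$ knows all $p_j$ in advance (but must still test $j$ in order to run it in time $p_j$), and its cost is the minimum cost of any schedule; it spends $\min\{u_j,t_j+p_j\}$ on job $j$ and runs jobs in non-decreasing order of this quantity whenever a machine is available. An algorithm $A$ is $c$-competitive on a class of instances if $\mathrm{cost}(A)\le c\cdot\mathrm{cost}(\mathrm{OPT})$ on all instances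 of the class. -}

module Defs where

open import Level using (Level; suc) renaming (_⊔_ to _⊔ℓ_)
open import Algebra.Bundles using (CommutativeRing)
import Algebra.Construct.NaturalChoice.Max as Max
import Algebra.Definitions.RawMonoid as RawMonoid
open import Data.Fin.Base using (Fin)
open import Data.Maybe.Base using (Maybe; just; nothing)
open import Data.Nat.Base using (ℕ)
open import Data.Product.Base using (∃-syntax; _×_; _,_)
open import Data.Sum.Base using (_⊎_)
open import Function.Bundles using (_⇔_)
open import Relation.Binary.Bundles using (DecTotalOrder)
open import Relation.Binary.Core using (Rel)
open import Relation.Binary.PropositionalEquality.Core using (_≡_; _≢_)
open import Relation.Binary.Structures using (IsDecTotalOrder)
open import Relation.Nullary.Negation.Core using (¬_)

-- The standard library has no real numbers.  Times and the parameter α are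
-- elements of an arbitrary ordered field; classically, ℝ is an instance.
record OrderedField (c ℓ₁ ℓ₂ : Level) : Set (suc (c ⊔ℓ ℓ₁ ⊔ℓ ℓ₂)) where
  infix  4 _≤_ _<_
  infixl 7 _/_
  infix  8 _⁻¹
  field
    commutativeRing : CommutativeRing c ℓ₁

  open CommutativeRing commutativeRing public

  field
    _≤_             : Rel Carrier ℓ₂
    isDecTotalOrder : IsDecTotalOrder _≈_ _≤_
    +-monoʳ-≤       : ∀ x {y z} → y ≤ z → x + y ≤ x + z
    *-nonNeg        : ∀ {x y} → 0# ≤ x → 0# ≤ y → 0# ≤ x * y
    0≉1             : ¬ 0# ≈ 1#
    -- The value of 0# ⁻¹ is unspecified.
    _⁻¹             : Carrier → Carrier
    *-inverseʳ      : ∀ {x} → ¬ x ≈ 0# → x * x ⁻¹ ≈ 1#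

  decTotalOrder : DecTotalOrder c ℓ₁ ℓ₂
  decTotalOrder = record { isDecTotalOrder = isDecTotalOrder }

  open Max (DecTotalOrder.totalOrder decTotalOrder) public using (_⊔_)

  open RawMonoid +-rawMonoid public using (sum) renaming (_×_ to _·_)

  _<_ : Rel Carrier (ℓ₁ ⊔ℓ ℓ₂)
  x < y = x ≤ y × ¬ x ≈ y

  _/_ : Carrier → Carrier → Carrier
  x / y = x * y ⁻¹

  fromℕ : ℕ → Carrier
  fromℕ k = k · 1#

  2# : Carrier
  2# = fromℕ 2

module Scheduling {c ℓ₁ ℓ₂} (F : OrderedField c ℓ₁ ℓ₂) where
  open OrderedField F

  record Instance (n : ℕ) : Set (c ⊔ℓ ℓ₁ ⊔ℓ ℓ₂) where
    field
      t        : Fin n → Carrier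
      u        : Fin n → Carrier
      t-pos    : ∀ j → 0# < t j
      u-nonNeg : ∀ j → 0# ≤ u j

  record Realisation {n} (I : Instance n) : Set (c ⊔ℓ ℓ₂) where
    open Instance I
    field
      p        : Fin n → Carrier
      p-nonNeg : ∀ j → 0# ≤ p j
      p≤u      : ∀ j → p j ≤ u j

  record Slot (m : ℕ) : Set c where
    constructor _at_
    field
      machine : Fin m
      start   : Carrier

  open Slot public

  -- untested a : the untested execution occupies a;
  -- tested a b : the test occupies a, the subsequent execution occupies b.
  data Plan (m : ℕ) : Set c where
    untested : Slot m → Plan m
    tested   : Slot m → Slot m → Plan m

  Schedule : ℕ → ℕ → Set c
  Schedule n m = Fin n → Plan m

  data Task : Set where
    full test run : Task

  slot : ∀ {m} → Plan m → Task → Maybe (Slot m)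
  slot (untested a) full = just a
  slot (tested a b) test = just a
  slot (tested a b) run  = just b
  slot _            _    = nothing

  module _ {n} (I : Instance n) (P : Realisation I) where
    open Instance I
    open Realisation P

    duration : Fin n → Task → Carrier
    duration j full = u j
    duration j test = t j
    duration j run  = p j

    record Feasible {m} (S : Schedule n m) : Set (c ⊔ℓ ℓ₂) where
      field
        start-nonNeg    : ∀ {j k a} → slot (S j) k ≡ just a → 0# ≤ start a
        test-before-run : ∀ {j a b} → S j ≡ tested a b → start a + t j ≤ start b
        no-overlap      : ∀ {i j k l a b} → (i , k) ≢ (j , l) →
                          slot (S i) k ≡ just a → slot (S j) l ≡ just b →
                          machine a ≡ machine b →
                          start a + duration i k ≤ start b ⊎
                          start b + duration j l ≤ start a

    completion : ∀ {m} → Schedule n m → Fin n → Carrier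
    completion S j with S j
    ... | untested a = start a + u j
    ... | tested a b = start b + p j

    cost : ∀ {m} → Schedule n m → Carrier
    cost S = sum (completion S)

  Starts : ∀ {n m} → Schedule n m → Fin n → Task → Slot m → Set (c ⊔ℓ ℓ₁)
  Starts S j k a =
    ∃[ b ] slot (S j) k ≡ just b × machine b ≡ machine a × start b ≈ start a

  TestFinishedBy : ∀ {n m} → Instance n → Carrier → Schedule n m → Fin n → Set (c ⊔ℓ ℓ₂)
  TestFinishedBy I τ S j =
    ∃[ a ] slot (S j) test ≡ just a × start a + Instance.t I j ≤ τ

  AgreeUpTo : ∀ {n m} → Carrier → Schedule n m → Schedule n m → Set (c ⊔ℓ ℓ₁ ⊔ℓ ℓ₂)
  AgreeUpTo τ S S′ = ∀ j k a → start a ≤ τ → Starts S j k a ⇔ Starts S′ j k a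

  -- A deterministic online algorithm is given by the schedules it produces.
  -- It is online in that what it starts up to time τ depends only on the
  -- instance and on the p j of jobs whose test has finished by time τ.
  record OnlineAlgorithm (m : ℕ) : Set (c ⊔ℓ ℓ₁ ⊔ℓ ℓ₂) where
    open Realisation
    field
      schedule        : ∀ {n} (I : Instance n) → Realisation I → Schedule n m
      feasible        : ∀ {n} (I : Instance n) P → Feasible I P (schedule I P)
      nonAnticipating : ∀ {n} (I : Instance n) (P P′ : Realisation I) τ →
                        (∀ j → TestFinishedBy I τ (schedule I P) j → p P j ≈ p P′ j) →
                        AgreeUpTo τ (schedule I P) (schedule I P′)

  -- cost(OPT) is the minimum of cost I P S over all feasible S, so the
  -- algorithm is compared with every feasible S; S may depend on all of P.
  CompetitiveOn : ∀ {m ℓ} → (∀ {n} → Instance n → Set ℓ) →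
                  Carrier → OnlineAlgorithm m → Set (c ⊔ℓ ℓ₁ ⊔ℓ ℓ₂ ⊔ℓ ℓ)
  CompetitiveOn {m} Class ρ A =
    ∀ {n} (I : Instance n) → Class I → ∀ P (S : Schedule n m) → Feasible I P S →
    cost I P (OnlineAlgorithm.schedule A I P) ≤ ρ * cost I P S

  UniformTests : ∀ {n} → Instance n → Set ℓ₁
  UniformTests I = ∀ i j → Instance.t I i ≈ Instance.t I j

-- The algorithm runs all tests before any tested job is executed, which costs no
-- more than the factor R allows.  Writing q = min(u, t + p), comparing the mutual
-- delays of each pair of jobs gives, with the sum over all ordered pairs,
--   2m ALG ≤ R (∑ min(qᵢ, qⱼ) + ∑ q) + 2 (m - 1) r ∑ q,
-- where r bounds the work spent on a job, relative to q.  Conversely,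
--   2m OPT ≥ ∑ min(qᵢ, qⱼ) + m ∑ q   and   OPT ≥ ∑ q,
-- and R ≤ 2r allows the three bounds to be combined.  For the bound on OPT, job j
-- with completion time C is given the concave function min(s, C) + min(s, C - q);
-- on each machine its increments over all tasks add up to at most 2C - q, while for
-- two jobs i and j the increments of each one's function over the other's tasks add
-- up to at least 2 min(qᵢ, qⱼ).
module Submission where

open import Defs
import Algebra.Construct.NaturalChoice.Max as Max
import Algebra.Construct.NaturalChoice.Min as Min
import Algebra.Properties.Ring as RingProperties
import Algebra.Properties.Semiring.Sum as SemiringSum
import Algebra.Solver.Ring.NaturalCoefficients.Default as Solver
open import Data.Bool.Base using (Bool; true; false; if_then_else_)
open import Data.Fin.Base using (Fin; zero; suc)
open import Data.Fin.Properties using (_≟_)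
open import Data.List.Base using (List; []; _∷_; foldr; tabulate; allFin; cartesianProduct)
open import Data.List.Membership.Propositional using (_∈_)
open import Data.List.Membership.Propositional.Properties using (∈-allFin)
open import Data.List.Relation.Binary.Permutation.Propositional using (_↭_; prep; swap; ↭-sym) renaming (refl to ↭-refl; trans to ↭-trans)
open import Data.List.Relation.Binary.Permutation.Propositional.Properties using (∈-resp-↭)
open import Data.List.Relation.Unary.All as All using (All; []; _∷_)
open import Data.List.Relation.Unary.AllPairs using (AllPairs; []; _∷_)
open import Data.List.Relation.Unary.Any using (here; there)
open import Data.List.Relation.Unary.Sorted.TotalOrder.Properties using (Sorted⇒AllPairs)
open import Data.List.Relation.Unary.Unique.Propositional using (Unique)
open import Data.List.Relation.Unary.Unique.Propositional.Properties using (allFin⁺; cartesianProduct⁺)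
open import Data.List.Sort.Base using (SortingAlgorithm)
import Data.List.Sort.InsertionSort as InsertionSort
open import Data.Maybe.Base using (just; nothing; maybe)
open import Data.Nat.Base using (ℕ; NonZero; zero; suc)
open import Data.Product.Base using (∃-syntax; _×_; _,_; proj₁; proj₂)
open import Data.Sum.Base using (_⊎_; inj₁; inj₂)
open import Data.Vec.Functional as Vector using (updateAt)
open import Data.Vec.Functional.Properties using (updateAt-updates; updateAt-minimal)
open import Function.Bundles using (mk⇔)
open import Function.Base using (_∘_)
open import Relation.Binary.Bundles using (DecTotalOrder)
import Relation.Binary.Construct.On as On
import Relation.Binary.Reasoning.PartialOrder as PosetReasoning
open import Relation.Binary.PropositionalEquality as ≡ using (_≡_; _≢_)
open import Relation.Nullary.Decidable.Core using (yes; no; does)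
open import Relation.Nullary.Negation.Core using (¬_; contradiction)

-- The first bound on OPT is the Eastman-Even-Isaacs bound for identical machines. It is reproved
-- here because the competing schedule is an arbitrary feasible one: a test and its run may be apart
-- in time and on different machines, and a job may be tested although `u` is smaller. The function
-- of job j has slope 2 before `C - q`, slope 1 from there to `C`, and slope 0 afterwards, so that
-- work done beside j on another machine counts half as much as work done before it. The constants
-- come from the threshold `u < α t`. Without a test a job costs `u ≤ α t ≤ α (t + p)`; with a test
-- it costs `t + p`, which is at most `(1 + 1/α) u`. This gives r. Two tested jobs delay each other
-- by both tests and the smaller run; with equal testing times this is `2 t + p`, to be compared
-- with `t + p` and with `u`, whence the 2 and the `1 + 2/α` in R.

-- Ordered fields, finite sums, and increments of monotone functions over disjoint intervals.

module OrderedFieldProperties {c ℓ₁ ℓ₂} (F : OrderedField c ℓ₁ ℓ₂) where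
  open OrderedField F hiding (zero)
  open DecTotalOrder decTotalOrder public
    using (_≤?_; total; antisym; totalOrder; poset)
    renaming (refl to ≤-refl; trans to ≤-trans; reflexive to ≤-reflexive)
  open Min totalOrder public
  open Max totalOrder public
    using (x≤x⊔y; x≤y⊔x; ⊔-lub; ⊔-monoˡ-≤; x≤y⇒x⊔y≈y; x≤y⇒y⊔x≈y)
  open RingProperties ring public using (-‿distribˡ-*; -‿involutive; +-cancelʳ)
  open SemiringSum semiring public
    using (sum-cong-≋; ∑-distrib-+; ∑-comm; *-distribˡ-sum)
  open Solver commutativeSemiring public
  open PosetReasoning poset public hiding (start)

  con2 : ∀ {n} → Polynomial n
  con2 = con 1 :+ (con 1 :+ con 0)

  +-mono-≤ : ∀ {w x y z} → w ≤ x → y ≤ z → w + y ≤ x + z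
  +-mono-≤ {w} {x} {y} {z} w≤x y≤z = begin
    w + y  ≤⟨ +-monoʳ-≤ w y≤z ⟩
    w + z  ≈⟨ +-comm w z ⟩
    z + w  ≤⟨ +-monoʳ-≤ z w≤x ⟩
    z + x  ≈⟨ +-comm z x ⟩
    x + z  ∎

  +-cancelʳ-≤ : ∀ {x y} z → x + z ≤ y + z → x ≤ y
  +-cancelʳ-≤ {x} {y} z x+z≤y+z = begin
    x              ≈⟨ cancel x ⟨
    x + z + - z    ≤⟨ +-mono-≤ x+z≤y+z ≤-refl ⟩
    y + z + - z    ≈⟨ cancel y ⟩
    y              ∎
    where
    cancel : ∀ w → w + z + - z ≈ w
    cancel w = trans (+-assoc w z (- z)) (trans (+-congˡ (-‿inverseʳ z)) (+-identityʳ w))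

  -- l ≤ r is meant to be a sum of hypotheses; the remaining identity is free of
  -- subtraction, hence within reach of the semiring solver.
  ≤-from : ∀ {e f l r} → l ≤ r → e + r ≈ f + l → e ≤ f
  ≤-from {e} {f} {l} {r} l≤r e+r≈f+l = +-cancelʳ-≤ r (begin
    e + r  ≈⟨ e+r≈f+l ⟩
    f + l  ≤⟨ +-monoʳ-≤ f l≤r ⟩
    f + r  ∎)

  x+y≥x : ∀ {x y} → 0# ≤ y → x ≤ x + y
  x+y≥x {x} {y} 0≤y = begin
    x       ≈⟨ +-identityʳ x ⟨
    x + 0#  ≤⟨ +-monoʳ-≤ x 0≤y ⟩
    x + y   ∎

  +-nonNeg : ∀ {x y} → 0# ≤ x → 0# ≤ y → 0# ≤ x + y
  +-nonNeg 0≤x 0≤y = ≤-trans 0≤x (x+y≥x 0≤y)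

  *-monoʳ-≤ : ∀ {x y z} → 0# ≤ x → y ≤ z → x * y ≤ x * z
  *-monoʳ-≤ {x} {y} {z} 0≤x y≤z = begin
    x * y                    ≤⟨ x+y≥x (*-nonNeg 0≤x 0≤z-y) ⟩
    x * y + x * (- y + z)    ≈⟨ distribˡ x y (- y + z) ⟨
    x * (y + (- y + z))      ≈⟨ *-congˡ (+-assoc y (- y) z) ⟨
    x * (y + - y + z)        ≈⟨ *-congˡ (+-congʳ (-‿inverseʳ y)) ⟩
    x * (0# + z)             ≈⟨ *-congˡ (+-identityˡ z) ⟩
    x * z                    ∎
    where
    0≤z-y : 0# ≤ - y + z
    0≤z-y = begin
      0#       ≈⟨ -‿inverseˡ y ⟨
      - y + y  ≤⟨ +-monoʳ-≤ (- y) y≤z ⟩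
      - y + z  ∎

  *-monoˡ-≤ : ∀ {x y z} → 0# ≤ x → y ≤ z → y * x ≤ z * x
  *-monoˡ-≤ {x} {y} {z} 0≤x y≤z = begin
    y * x  ≈⟨ *-comm y x ⟩
    x * y  ≤⟨ *-monoʳ-≤ 0≤x y≤z ⟩
    x * z  ≈⟨ *-comm x z ⟩
    z * x  ∎

  *-cancelˡ-≤ : ∀ {x y z} → 0# ≤ x → ¬ x ≈ 0# → x * y ≤ x * z → y ≤ z
  *-cancelˡ-≤ {x} {y} {z} 0≤x x≉0 xy≤xz with total y z
  ... | inj₁ y≤z = y≤z
  ... | inj₂ z≤y = begin
    y              ≈⟨ cancel y ⟨
    x ⁻¹ * (x * y)  ≈⟨ *-congˡ (antisym xy≤xz (*-monoʳ-≤ 0≤x z≤y)) ⟩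
    x ⁻¹ * (x * z)  ≈⟨ cancel z ⟩
    z              ∎
    where
    cancel : ∀ w → x ⁻¹ * (x * w) ≈ w
    cancel w = trans (sym (*-assoc (x ⁻¹) x w))
      (trans (*-congʳ (trans (*-comm (x ⁻¹) x) (*-inverseʳ x≉0))) (*-identityˡ w))

  0≤1 : 0# ≤ 1#
  0≤1 with total 0# 1#
  ... | inj₁ 0≤1 = 0≤1
  ... | inj₂ 1≤0 = begin
    0#           ≤⟨ *-nonNeg 0≤-1 0≤-1 ⟩
    - 1# * - 1#  ≈⟨ -‿distribˡ-* 1# (- 1#) ⟨
    - (1# * - 1#) ≈⟨ -‿cong (*-identityˡ (- 1#)) ⟩
    - - 1#       ≈⟨ -‿involutive 1# ⟩
    1#           ∎
    where
    0≤-1 : 0# ≤ - 1#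
    0≤-1 = begin
      0#         ≈⟨ -‿inverseˡ 1# ⟨
      - 1# + 1#  ≤⟨ +-monoʳ-≤ (- 1#) 1≤0 ⟩
      - 1# + 0#  ≈⟨ +-identityʳ (- 1#) ⟩
      - 1#       ∎

  1≤x⇒0≤x : ∀ {x} → 1# ≤ x → 0# ≤ x
  1≤x⇒0≤x = ≤-trans 0≤1

  1≤x⇒x≉0 : ∀ {x} → 1# ≤ x → ¬ x ≈ 0#
  1≤x⇒x≉0 1≤x x≈0 = 0≉1 (antisym 0≤1 (≤-trans 1≤x (≤-reflexive x≈0)))

  1≤x⇒y≤xy : ∀ {x y} → 1# ≤ x → 0# ≤ y → y ≤ x * y
  1≤x⇒y≤xy {x} {y} 1≤x 0≤y = begin
    y       ≈⟨ *-identityˡ y ⟨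
    1# * y  ≤⟨ *-monoˡ-≤ 0≤y 1≤x ⟩
    x * y   ∎

  fromℕ-nonNeg : ∀ k → 0# ≤ fromℕ k
  fromℕ-nonNeg zero    = ≤-refl
  fromℕ-nonNeg (suc k) = +-nonNeg 0≤1 (fromℕ-nonNeg k)

  1≤fromℕ : ∀ k → 1# ≤ fromℕ (suc k)
  1≤fromℕ k = x+y≥x (fromℕ-nonNeg k)

  -- Serves to bound a quantity by a multiple of `q = u ⊓ (t + p)`: one proof against each argument.
  ⊓-selects : ∀ {ℓ} (P : Carrier → Set ℓ) {x y} → P x → P y → P (x ⊓ y)
  ⊓-selects P {x} {y} px py with total x y
  ... | inj₁ _ = px
  ... | inj₂ _ = py

  ≤⊎≥⇒⊓ : ∀ x y → (x ≤ y × x ⊓ y ≈ x) ⊎ (y ≤ x × x ⊓ y ≈ y)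
  ≤⊎≥⇒⊓ x y with total x y
  ... | inj₁ x≤y = inj₁ (x≤y , refl)
  ... | inj₂ y≤x = inj₂ (y≤x , refl)

  sum-mono-≤ : ∀ {n} {f g : Fin n → Carrier} → (∀ i → f i ≤ g i) → sum f ≤ sum g
  sum-mono-≤ {zero}  f≤g = ≤-refl
  sum-mono-≤ {suc n} f≤g = +-mono-≤ (f≤g zero) (sum-mono-≤ (f≤g ∘ suc))

  sum-nonNeg : ∀ {n} {f : Fin n → Carrier} → (∀ i → 0# ≤ f i) → 0# ≤ sum f
  sum-nonNeg {zero}  0≤f = ≤-refl
  sum-nonNeg {suc n} 0≤f = +-nonNeg (0≤f zero) (sum-nonNeg (0≤f ∘ suc))

  sum-const : ∀ n x → sum {n} (λ _ → x) ≈ fromℕ n * x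
  sum-const zero    x = sym (zeroˡ x)
  sum-const (suc n) x = begin-equality
    x + sum {n} (λ _ → x)  ≈⟨ +-congˡ (sum-const n x) ⟩
    x + fromℕ n * x        ≈⟨ solve 2 (λ x k → x :+ k :* x := (con 1 :+ k) :* x) refl x (fromℕ n) ⟩
    (1# + fromℕ n) * x     ∎

  listSum : ∀ {a} {A : Set a} → List A → (A → Carrier) → Carrier
  listSum xs f = foldr (λ x s → f x + s) 0# xs

  listSum-cong : ∀ {a} {A : Set a} (xs : List A) {f g : A → Carrier} →
                 All (λ x → f x ≈ g x) xs → listSum xs f ≈ listSum xs g
  listSum-cong []       []            = refl
  listSum-cong (x ∷ xs) (fx≈gx ∷ f≈g) = +-cong fx≈gx (listSum-cong xs f≈g)

  listSum-tabulate : ∀ {a} {A : Set a} {n} (g : Fin n → A) (f : A → Carrier) →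
                     listSum (tabulate g) f ≡ sum (f ∘ g)
  listSum-tabulate {n = zero}  g f = ≡.refl
  listSum-tabulate {n = suc n} g f = ≡.cong (f (g zero) +_) (listSum-tabulate (g ∘ suc) f)

  sum-listSum-comm : ∀ {a} {A : Set a} {n} (xs : List A) (f : Fin n → A → Carrier) →
                     sum (λ i → listSum xs (f i)) ≈ listSum xs (λ x → sum (λ i → f i x))
  sum-listSum-comm {n = n} []       f = trans (sum-const n 0#) (zeroʳ (fromℕ n))
  sum-listSum-comm         (x ∷ xs) f =
    trans (∑-distrib-+ (λ i → f i x) (λ i → listSum xs (f i))) (+-congˡ (sum-listSum-comm xs f))

  sum-indicator : ∀ {n} (i : Fin n) x → sum (λ j → if does (i ≟ j) then x else 0#) ≈ x
  sum-indicator {suc n} zero    x = trans (+-congˡ (trans (sum-const n 0#) (zeroʳ (fromℕ n)))) (+-identityʳ x)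
  sum-indicator {suc n} (suc i) x = trans (+-identityˡ _) (sum-indicator i x)

  Monotone : (Carrier → Carrier) → Set _
  Monotone f = ∀ {x y} → x ≤ y → f x ≤ f y

  monotone⇒cong : ∀ {f} → Monotone f → ∀ {x y} → x ≈ y → f x ≈ f y
  monotone⇒cong mono x≈y = antisym (mono (≤-reflexive x≈y)) (mono (≤-reflexive (sym x≈y)))

  x≤y+z⇒x-z≤y : ∀ {x y z} → x ≤ y + z → x - z ≤ y
  x≤y+z⇒x-z≤y {x} {y} {z} x≤y+z = begin
    x + - z          ≤⟨ +-mono-≤ x≤y+z ≤-refl ⟩
    y + z + - z      ≈⟨ +-assoc y z (- z) ⟩
    y + (z + - z)    ≈⟨ +-congˡ (-‿inverseʳ z) ⟩
    y + 0#           ≈⟨ +-identityʳ y ⟩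
    y                ∎

  x-y+y≈x : ∀ x y → x - y + y ≈ x
  x-y+y≈x x y = trans (+-assoc x (- y) y) (trans (+-congˡ (-‿inverseˡ y)) (+-identityʳ x))

  x+z≤y⇒x≤y-z : ∀ {x y z} → x + z ≤ y → x ≤ y - z
  x+z≤y⇒x≤y-z {x} {y} {z} x+z≤y = +-cancelʳ-≤ z (≤-trans x+z≤y (≤-reflexive (sym (x-y+y≈x y z))))

  [x+z]-[y+z]≈x-y : ∀ x y z → (x + z) - (y + z) ≈ x - y
  [x+z]-[y+z]≈x-y x y z = antisym
    (x≤y+z⇒x-z≤y (≤-reflexive (begin-equality
      x + z                  ≈⟨ +-congʳ (x-y+y≈x x y) ⟨
      x - y + y + z          ≈⟨ +-assoc (x - y) y z ⟩
      x - y + (y + z)        ∎)))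
    (x≤y+z⇒x-z≤y (+-cancelʳ-≤ z (≤-reflexive (begin-equality
      x + z                              ≈⟨ x-y+y≈x (x + z) (y + z) ⟨
      (x + z) - (y + z) + (y + z)        ≈⟨ +-assoc _ y z ⟨
      (x + z) - (y + z) + y + z          ∎))))

  module _ {a} {A : Set a} (lo hi : A → Carrier)
           (lo-nonNeg : ∀ x → 0# ≤ lo x) (lo≤hi : ∀ x → lo x ≤ hi x)
           (disjoint : ∀ {x y} → x ≢ y → hi x ≤ lo y ⊎ hi y ≤ lo x) where

    -- Induction on the intervals: the first one, [ lo x , hi x ], is contracted
    -- by passing to s ↦ f (s ⊓ lo x) + f (s ⊔ hi x), which is constant on it and
    -- has the same increments as f on every interval disjoint from it.
    packing : ∀ {xs} → Unique xs → ∀ {f} b → Monotone f → (∀ s → f s ≤ b) →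
              f 0# + listSum xs (λ x → f (hi x) - f (lo x)) ≤ b
    packing {[]}     []           {f} b mono f≤b = ≤-trans (≤-reflexive (+-identityʳ (f 0#))) (f≤b 0#)
    packing {x ∷ xs} (x∉xs ∷ xs!) {f} b mono f≤b = begin
      f 0# + (f (hi x) - f (lo x) + Σf)
        ≈⟨ solve 4 (λ f0 fh fl s → f0 :+ ((fh :+ fl) :+ s) := (f0 :+ fh :+ s) :+ fl) refl (f 0#) (f (hi x)) (- f (lo x)) Σf ⟩
      f 0# + f (hi x) + Σf - f (lo x)
        ≈⟨ +-congʳ (+-cong g0 (listSum-cong xs (All.map same-increment x∉xs))) ⟨
      g 0# + listSum xs (λ y → g (hi y) - g (lo y)) - f (lo x)
        ≤⟨ x≤y+z⇒x-z≤y (packing xs! (b + f (lo x)) g-mono g≤) ⟩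
      b ∎
      where
      Σf = listSum xs (λ y → f (hi y) - f (lo y))

      g : Carrier → Carrier
      g s = f (s ⊔ hi x) + f (s ⊓ lo x)

      f-cong : ∀ {y z} → y ≈ z → f y ≈ f z
      f-cong = monotone⇒cong mono

      g-mono : Monotone g
      g-mono y≤z = +-mono-≤ (mono (⊔-monoˡ-≤ (hi x) y≤z)) (mono (⊓-monoˡ-≤ (lo x) y≤z))

      g≤ : ∀ s → g s ≤ b + f (lo x)
      g≤ s = +-mono-≤ (f≤b (s ⊔ hi x)) (mono (x⊓y≤y s (lo x)))

      g-below : ∀ {s} → s ≤ lo x → g s ≈ f s + f (hi x)
      g-below s≤lo = trans
        (+-cong (f-cong (x≤y⇒x⊔y≈y (≤-trans s≤lo (lo≤hi x)))) (f-cong (x≤y⇒x⊓y≈x s≤lo)))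
        (+-comm (f (hi x)) (f _))

      g-above : ∀ {s} → hi x ≤ s → g s ≈ f s + f (lo x)
      g-above hi≤s =
        +-cong (f-cong (x≤y⇒y⊔x≈y hi≤s)) (f-cong (x≤y⇒y⊓x≈x (≤-trans (lo≤hi x) hi≤s)))

      g0 : g 0# ≈ f 0# + f (hi x)
      g0 = g-below (lo-nonNeg x)

      same-increment : ∀ {y} → x ≢ y → g (hi y) - g (lo y) ≈ f (hi y) - f (lo y)
      same-increment {y} x≢y with disjoint x≢y
      ... | inj₁ hi≤lo = trans
        (+-cong (g-above (≤-trans hi≤lo (lo≤hi y))) (-‿cong (g-above hi≤lo)))
        ([x+z]-[y+z]≈x-y (f (hi y)) (f (lo y)) (f (lo x)))
      ... | inj₂ hi≤lo = trans
        (+-cong (g-below hi≤lo) (-‿cong (g-below (≤-trans (lo≤hi y) hi≤lo))))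
        ([x+z]-[y+z]≈x-y (f (hi y)) (f (lo y)) (f (hi x)))

  -- Concavity of `s ↦ s ⊓ c`, with the differences rearranged into sums. In the three cases the
  -- step from `y` gains nothing, the step from `x` gains all of `d`, or both steps end at the value
  -- `c`.
  ⊓-shift : ∀ c {x y d} → x ≤ y → 0# ≤ d →
            (y + d) ⊓ c + x ⊓ c ≤ (x + d) ⊓ c + y ⊓ c
  ⊓-shift c {x} {y} {d} x≤y 0≤d with ≤⊎≥⇒⊓ y c
  ... | inj₂ (c≤y , y⊓c≈c) = begin
    (y + d) ⊓ c + x ⊓ c  ≤⟨ +-mono-≤ (x⊓y≤y (y + d) c) (⊓-monoˡ-≤ c (x+y≥x 0≤d)) ⟩
    c + (x + d) ⊓ c      ≈⟨ +-comm c _ ⟩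
    (x + d) ⊓ c + c      ≈⟨ +-congˡ y⊓c≈c ⟨
    (x + d) ⊓ c + y ⊓ c  ∎
  ... | inj₁ (y≤c , y⊓c≈y) with ≤⊎≥⇒⊓ (x + d) c
  ...   | inj₁ (x+d≤c , x+d⊓c≈x+d) = begin
    (y + d) ⊓ c + x ⊓ c  ≤⟨ +-mono-≤ (x⊓y≤x (y + d) c) (x⊓y≤x x c) ⟩
    (y + d) + x          ≈⟨ solve 3 (λ x y d → (y :+ d) :+ x := (x :+ d) :+ y) refl x y d ⟩
    (x + d) + y          ≈⟨ +-cong x+d⊓c≈x+d y⊓c≈y ⟨
    (x + d) ⊓ c + y ⊓ c  ∎
  ...   | inj₂ (c≤x+d , x+d⊓c≈c) = begin
    (y + d) ⊓ c + x ⊓ c  ≤⟨ +-mono-≤ (x⊓y≤y (y + d) c) (⊓-monoˡ-≤ c x≤y) ⟩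
    c + y ⊓ c            ≈⟨ +-congʳ x+d⊓c≈c ⟨
    (x + d) ⊓ c + y ⊓ c  ∎

  -- The sum of the completion times of jobs of lengths f on one machine, in
  -- non-decreasing order of length, is (∑∑⊓ f f + sum f) / 2.
  ∑∑⊓ : ∀ {n} → (f g : Fin n → Carrier) → Carrier
  ∑∑⊓ f g = sum (λ j → sum (λ i → f i ⊓ g j))

  ∑∑⊓-comm : ∀ {n} (f g : Fin n → Carrier) → ∑∑⊓ f g ≈ ∑∑⊓ g f
  ∑∑⊓-comm f g = trans (∑-comm (λ j i → f i ⊓ g j))
    (sum-cong-≋ (λ i → sum-cong-≋ (λ j → ⊓-comm (f i) (g j))))

-- Lower bounds on the cost of an arbitrary feasible schedule.

module LowerBound {c ℓ₁ ℓ₂} (F : OrderedField c ℓ₁ ℓ₂) where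
  open OrderedField F hiding (zero)
  open OrderedFieldProperties F
  open Scheduling F

  completion-untested : ∀ {n m} (I : Instance n) P (S : Schedule n m) j {a} →
    S j ≡ untested a → completion I P S j ≡ start a + Instance.u I j
  completion-untested I P S j eq rewrite eq = ≡.refl

  completion-tested : ∀ {n m} (I : Instance n) P (S : Schedule n m) j {a b} →
    S j ≡ tested a b → completion I P S j ≡ start b + Realisation.p P j
  completion-tested I P S j eq rewrite eq = ≡.refl

  allTasks : List Task
  allTasks = full ∷ test ∷ run ∷ []

  allTasks-unique : Unique allTasks
  allTasks-unique = ((λ ()) ∷ (λ ()) ∷ []) ∷ ((λ ()) ∷ []) ∷ [] ∷ []

  optTime : ∀ {n} (I : Instance n) → Realisation I → Fin n → Carrier
  optTime I P j = u j ⊓ (t j + p j)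
    where
    open Instance I
    open Realisation P

  module _ {n m} (I : Instance n) (P : Realisation I) {S : Schedule n m} (feasible : Feasible I P S) where
    open Instance I
    open Realisation P
    open Feasible feasible

    private
      q : Fin n → Carrier
      q = optTime I P

      C : Fin n → Carrier
      C = completion I P S

      latestStart : Fin n → Carrier
      latestStart j = C j - q j

    duration-nonNeg : ∀ j k → 0# ≤ duration I P j k
    duration-nonNeg j full = u-nonNeg j
    duration-nonNeg j test = proj₁ (t-pos j)
    duration-nonNeg j run  = p-nonNeg j

    Item : Set
    Item = Fin n × Task

    items : List Item
    items = cartesianProduct (allFin n) allTasks

    increment : (Carrier → Carrier) → Item → Carrier
    increment f (j , k) = maybe (λ a → f (start a + duration I P j k) - f (start a)) 0# (slot (S j) k)

    -- Items that do not run on machine M are given the empty interval at 0.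
    interval : Fin m → Item → Carrier × Carrier
    interval M (j , k) with slot (S j) k
    ... | nothing = 0# , 0#
    ... | just a  = if does (machine a ≟ M) then (start a , start a + duration I P j k) else (0# , 0#)

    -- A view of `interval` that remembers the origin of its value, so that the nested case
    -- distinction on slot and machine is made only once.
    data OnMachine (M : Fin m) (x : Item) : Carrier × Carrier → Set c where
      empty  : OnMachine M x (0# , 0#)
      filled : ∀ {a} → slot (S (proj₁ x)) (proj₂ x) ≡ just a → machine a ≡ M →
               OnMachine M x (start a , start a + duration I P (proj₁ x) (proj₂ x))

    interval-view : ∀ M x → OnMachine M x (interval M x)
    interval-view M (j , k) with slot (S j) k in eq
    ... | nothing = empty
    ... | just a with machine a ≟ M
    ...   | yes a≡M = filled eq a≡M
    ...   | no  _   = empty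

    lo hi : Fin m → Item → Carrier
    lo M x = proj₁ (interval M x)
    hi M x = proj₂ (interval M x)

    lo-nonNeg : ∀ M x → 0# ≤ lo M x
    lo-nonNeg M x with interval M x | interval-view M x
    ... | _ | empty       = ≤-refl
    ... | _ | filled eq _ = start-nonNeg eq

    lo≤hi : ∀ M x → lo M x ≤ hi M x
    lo≤hi M x with interval M x | interval-view M x
    ... | _ | empty      = ≤-refl
    ... | _ | filled _ _ = x+y≥x (duration-nonNeg (proj₁ x) (proj₂ x))

    -- Starts are non-negative, so an empty interval placed at 0 precedes every slot; this is why
    -- the default sits there.
    disjoint : ∀ M {x y} → x ≢ y → hi M x ≤ lo M y ⊎ hi M y ≤ lo M x
    disjoint M {x} {y} x≢y with interval M x | interval-view M x | interval M y | interval-view M y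
    ... | _ | empty         | _ | empty         = inj₁ ≤-refl
    ... | _ | empty         | _ | filled eq _   = inj₁ (start-nonNeg eq)
    ... | _ | filled eq _   | _ | empty         = inj₂ (start-nonNeg eq)
    ... | _ | filled eq a≡M | _ | filled eq′ b≡M = no-overlap x≢y eq eq′ (≡.trans a≡M (≡.sym b≡M))

    -- Only the machine that carries the item contributes; all others add `f 0# - f 0#`. Thus one
    -- list of items serves for the packing bound on every machine.
    sum-increments : ∀ f x → sum (λ M → f (hi M x) - f (lo M x)) ≈ increment f x
    sum-increments f (j , k) with slot (S j) k
    ... | nothing = trans (sum-cong-≋ {m} (λ M → -‿inverseʳ (f 0#))) (trans (sum-const m 0#) (zeroʳ (fromℕ m)))
    ... | just a = trans (sum-cong-≋ pointwise) (sum-indicator (machine a) _)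
      where
      d = duration I P j k

      pointwise : ∀ M → let i = if does (machine a ≟ M) then (start a , start a + d) else (0# , 0#) in
                  f (proj₂ i) - f (proj₁ i) ≈ (if does (machine a ≟ M) then f (start a + d) - f (start a) else 0#)
      pointwise M with does (machine a ≟ M)
      ... | true  = refl
      ... | false = -‿inverseʳ (f 0#)

    listSum-items : ∀ {xs : List (Fin n)} (g : Item → Carrier) →
      listSum (cartesianProduct xs allTasks) g ≈ listSum xs (λ j → listSum allTasks (λ k → g (j , k)))
    listSum-items {[]}     g = refl
    listSum-items {j ∷ xs} g = trans
      (solve 4 (λ a b c s → a :+ (b :+ (c :+ s)) := (a :+ (b :+ (c :+ con 0))) :+ s) refl
        (g (j , full)) (g (j , test)) (g (j , run)) (listSum (cartesianProduct xs allTasks) g))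
      (+-congˡ (listSum-items {xs} g))

    increments≤ : ∀ f b → Monotone f → 0# ≤ f 0# → (∀ s → f s ≤ b) →
      sum (λ j → listSum allTasks (λ k → increment f (j , k))) ≤ fromℕ m * b
    increments≤ f b mono 0≤f0 f≤b = begin
      sum (λ j → listSum allTasks (λ k → increment f (j , k)))
        ≡⟨ listSum-tabulate (λ j → j) (λ j → listSum allTasks (λ k → increment f (j , k))) ⟨
      listSum (allFin n) (λ j → listSum allTasks (λ k → increment f (j , k)))
        ≈⟨ listSum-items {allFin n} (increment f) ⟨
      listSum items (increment f)
        ≈⟨ listSum-cong items (All.universal (sum-increments f) items) ⟨
      listSum items (λ x → sum (λ M → f (hi M x) - f (lo M x)))
        ≈⟨ sum-listSum-comm items (λ M x → f (hi M x) - f (lo M x)) ⟨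
      sum (λ M → listSum items (λ x → f (hi M x) - f (lo M x)))
        -- `packing` on each machine separately, after inserting the non-negative term `f 0#`.
        ≤⟨ sum-mono-≤ (λ M → ≤-trans (≤-trans (x+y≥x 0≤f0) (≤-reflexive (+-comm _ (f 0#))))
             (packing (lo M) (hi M) (lo-nonNeg M) (lo≤hi M) (disjoint M) items-unique b mono f≤b)) ⟩
      sum {m} (λ _ → b)
        ≈⟨ sum-const m b ⟩
      fromℕ m * b ∎
      where
      items-unique : Unique items
      items-unique = cartesianProduct⁺ (allFin⁺ n) allTasks-unique

    optTime≤completion : ∀ j → q j ≤ C j
    optTime≤completion j with S j in eq
    ... | untested a = begin
      u j ⊓ (t j + p j)  ≤⟨ x⊓y≤x (u j) _ ⟩
      u j                ≈⟨ +-identityˡ (u j) ⟨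
      0# + u j           ≤⟨ +-mono-≤ (start-nonNeg {j} {full} (≡.cong (λ s → slot s full) eq)) ≤-refl ⟩
      start a + u j      ∎
    ... | tested a b = begin
      u j ⊓ (t j + p j)    ≤⟨ x⊓y≤y (u j) _ ⟩
      t j + p j            ≈⟨ +-congʳ (+-identityˡ (t j)) ⟨
      0# + t j + p j       ≤⟨ +-mono-≤ (+-mono-≤ (start-nonNeg {j} {test} (≡.cong (λ s → slot s test) eq)) ≤-refl) ≤-refl ⟩
      start a + t j + p j  ≤⟨ +-mono-≤ (test-before-run eq) ≤-refl ⟩
      start b + p j        ∎

    sum-optTime≤cost : sum q ≤ cost I P S
    sum-optTime≤cost = sum-mono-≤ optTime≤completion

    -- A concave f grows least over the tasks of j if they are moved together, so
    -- as to end at C j without a break.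
    job-increment : ∀ f → Monotone f →
      (∀ {x y d} → x ≤ y → 0# ≤ d → f (y + d) + f x ≤ f (x + d) + f y) →
      ∀ j → f (C j) ≤ listSum allTasks (λ k → increment f (j , k)) + f (latestStart j)
    job-increment f mono shift j with S j in eq
    ... | untested a = begin
      f (start a + u j)
        ≈⟨ x-y+y≈x _ (f (start a)) ⟨
      f (start a + u j) - f (start a) + f (start a)
        ≤⟨ +-monoʳ-≤ _ (mono (x+z≤y⇒x≤y-z (+-monoʳ-≤ (start a) (x⊓y≤x (u j) _)))) ⟩
      f (start a + u j) - f (start a) + f (start a + u j - q j)
        ≈⟨ +-congʳ (solve 1 (λ x → x := x :+ (con 0 :+ (con 0 :+ con 0))) refl _) ⟩
      f (start a + u j) - f (start a) + (0# + (0# + 0#)) + f (start a + u j - q j) ∎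
    ... | tested a b = begin
      fc                                       ≈⟨ x-y+y≈x fc fb ⟨
      fc - fb + fb                             ≤⟨ +-monoʳ-≤ (fc - fb) (x+z≤y⇒x≤y-z fb+fa≤fat+fl) ⟩
      fc - fb + (fat + fl - fa)                ≈⟨ solve 4 (λ c t l a- → c :+ (t :+ l :+ a-) :=
                                                    con 0 :+ ((t :+ a-) :+ (c :+ con 0)) :+ l) refl (fc - fb) fat fl (- fa) ⟩
      0# + (fat - fa + (fc - fb + 0#)) + fl    ∎
      where
      fa = f (start a)
      fat = f (start a + t j)
      fb = f (start b)
      fc = f (start b + p j)
      fl = f (start b + p j - q j)

      -- Moved up to its run, the test would start at `start b - t j`; this is no later than the
      -- latest start, because `q j ≤ t j + p j`.
      late : start b - t j ≤ start b + p j - q j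
      late = x+z≤y⇒x≤y-z (begin
        start b - t j + q j     ≤⟨ +-monoʳ-≤ (start b - t j) (x⊓y≤y (u j) (t j + p j)) ⟩
        start b - t j + (t j + p j)   ≈⟨ +-assoc (start b - t j) (t j) (p j) ⟨
        start b - t j + t j + p j     ≈⟨ +-congʳ (x-y+y≈x (start b) (t j)) ⟩
        start b + p j                 ∎)

      fb+fa≤fat+fl : fb + fa ≤ fat + fl
      fb+fa≤fat+fl = begin
        fb + fa                          ≈⟨ +-congʳ (monotone⇒cong mono (x-y+y≈x (start b) (t j))) ⟨
        f (start b - t j + t j) + fa     ≤⟨ shift (x+z≤y⇒x≤y-z (test-before-run eq)) (proj₁ (t-pos j)) ⟩
        fat + f (start b - t j)          ≤⟨ +-monoʳ-≤ fat (mono late) ⟩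
        fat + fl                         ∎

    -- Summed over all pairs of jobs, the mixed terms C i ⊓ latestStart j of the
    -- functions s ↦ s ⊓ C j + s ⊓ latestStart j cancel.
    cost-lowerBound : ∑∑⊓ q q + fromℕ m * sum q ≤ fromℕ m * (2# * cost I P S)
    cost-lowerBound = begin
      -- `pairs` and `allJobs` together leave `QQ ≤ k * (sum C + sum L)`, and `sum L` is `sum C`
      -- less `Q`.
      QQ + k * Q               ≤⟨ ≤-from (+-mono-≤ pairs allJobs)
                                    (solve 8 (λ k q qq sc sl lc ll cc →
                                       (qq :+ k :* q) :+ (cc :+ (k :* (sc :+ sl) :+ (lc :+ ll))) :=
                                       k :* (sc :+ (sl :+ q)) :+ ((qq :+ ll) :+ (cc :+ lc)))
                                     refl k Q QQ (sum C) (sum L) LC LL CC) ⟩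
      k * (sum C + (sum L + Q))  ≈⟨ *-congˡ (+-congˡ L+Q≈C) ⟩
      k * (sum C + sum C)        ≈⟨ solve 2 (λ k x → k :* (x :+ x) := k :* (con2 :* x))
                                      refl k (sum C) ⟩
      k * (2# * sum C)           ∎
      where
      k = fromℕ m
      L = latestStart
      Q = sum q
      QQ = ∑∑⊓ q q
      CC = ∑∑⊓ C C
      LL = ∑∑⊓ L L
      LC = ∑∑⊓ L C

      f : Fin n → Carrier → Carrier
      f j s = s ⊓ C j + s ⊓ L j

      f-mono : ∀ j → Monotone (f j)
      f-mono j x≤y = +-mono-≤ (⊓-monoˡ-≤ (C j) x≤y) (⊓-monoˡ-≤ (L j) x≤y)

      L+o≈C : ∀ j → L j + q j ≈ C j
      L+o≈C j = x-y+y≈x (C j) (q j)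

      L+Q≈C : sum L + Q ≈ sum C
      L+Q≈C = trans (sym (∑-distrib-+ L q)) (sum-cong-≋ L+o≈C)

      f0-nonNeg : ∀ j → 0# ≤ f j 0#
      f0-nonNeg j = +-nonNeg
        (⊓-glb ≤-refl (≤-trans optTime-nonNeg (optTime≤completion j)))
        (⊓-glb ≤-refl (x+z≤y⇒x≤y-z (≤-trans (≤-reflexive (+-identityˡ _)) (optTime≤completion j))))
        where
        optTime-nonNeg : 0# ≤ q j
        optTime-nonNeg = ⊓-glb (u-nonNeg j) (+-nonNeg (proj₁ (t-pos j)) (p-nonNeg j))

      f-shift : ∀ j {x y d} → x ≤ y → 0# ≤ d → f j (y + d) + f j x ≤ f j (x + d) + f j y
      f-shift j {x} {y} {d} x≤y 0≤d = begin
        f j (y + d) + f j x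
          ≈⟨ interchange _ _ _ _ ⟩
        ((y + d) ⊓ C j + x ⊓ C j) + ((y + d) ⊓ L j + x ⊓ L j)
          ≤⟨ +-mono-≤ (⊓-shift (C j) x≤y 0≤d) (⊓-shift (L j) x≤y 0≤d) ⟩
        ((x + d) ⊓ C j + y ⊓ C j) + ((x + d) ⊓ L j + y ⊓ L j)
          ≈⟨ interchange _ _ _ _ ⟩
        f j (x + d) + f j y ∎
        where
        interchange : ∀ v w y z → (v + w) + (y + z) ≈ (v + y) + (w + z)
        interchange = solve 4 (λ v w y z → (v :+ w) :+ (y :+ z) := (v :+ y) :+ (w :+ z)) refl

      -- `f j` never exceeds `C j + L j`, so this is the room that each of the `k` machines offers
      -- to the increments of all jobs.
      perJob : ∀ j → sum (λ i → f j (C i)) ≤ k * (C j + L j) + sum (λ i → f j (L i))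
      perJob j = begin
        sum (λ i → f j (C i))
          ≤⟨ sum-mono-≤ (job-increment (f j) (f-mono j) (f-shift j)) ⟩
        sum (λ i → listSum allTasks (λ k → increment (f j) (i , k)) + f j (L i))
          ≈⟨ ∑-distrib-+ (λ i → listSum allTasks (λ k → increment (f j) (i , k))) (λ i → f j (L i)) ⟩
        sum (λ i → listSum allTasks (λ k → increment (f j) (i , k))) + sum (λ i → f j (L i))
          ≤⟨ +-mono-≤ (increments≤ (f j) (C j + L j) (f-mono j) (f0-nonNeg j)
               (λ s → +-mono-≤ (x⊓y≤y s (C j)) (x⊓y≤y s (L j)))) ≤-refl ⟩
        k * (C j + L j) + sum (λ i → f j (L i)) ∎

      sum-f : ∀ g → sum (λ j → sum (λ i → f j (g i))) ≈ ∑∑⊓ g C + ∑∑⊓ g L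
      sum-f g = trans
        (sum-cong-≋ (λ j → ∑-distrib-+ (λ i → g i ⊓ C j) (λ i → g i ⊓ L j)))
        (∑-distrib-+ (λ j → sum (λ i → g i ⊓ C j)) (λ j → sum (λ i → g i ⊓ L j)))

      allJobs : CC + LC ≤ k * (sum C + sum L) + (LC + LL)
      allJobs = begin
        CC + LC                                ≈⟨ +-congˡ (∑∑⊓-comm L C) ⟩
        CC + ∑∑⊓ C L                           ≈⟨ sum-f C ⟨
        sum (λ j → sum (λ i → f j (C i)))      ≤⟨ sum-mono-≤ perJob ⟩
        sum (λ j → k * (C j + L j) + sum (λ i → f j (L i)))
          ≈⟨ ∑-distrib-+ (λ j → k * (C j + L j)) (λ j → sum (λ i → f j (L i))) ⟩
        sum (λ j → k * (C j + L j)) + sum (λ j → sum (λ i → f j (L i)))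
          ≈⟨ +-cong (trans (sym (*-distribˡ-sum k (λ j → C j + L j))) (*-congˡ (∑-distrib-+ C L))) (sum-f L) ⟩
        k * (sum C + sum L) + (LC + LL) ∎

      -- The minimum is superadditive, and `C` splits as `q` plus `L`.
      pairs : QQ + LL ≤ CC
      pairs = begin
        QQ + LL
          ≈⟨ ∑-distrib-+ (λ j → sum (λ i → q i ⊓ q j)) (λ j → sum (λ i → L i ⊓ L j)) ⟨
        sum (λ j → sum (λ i → q i ⊓ q j) + sum (λ i → L i ⊓ L j))
          ≈⟨ sum-cong-≋ (λ j → ∑-distrib-+ (λ i → q i ⊓ q j) (λ i → L i ⊓ L j)) ⟨
        sum (λ j → sum (λ i → q i ⊓ q j + L i ⊓ L j))
          ≤⟨ sum-mono-≤ (λ j → sum-mono-≤ (λ i → ⊓-glb (pair i (x⊓y≤x _ _) (x⊓y≤x _ _)) (pair j (x⊓y≤y _ _) (x⊓y≤y _ _)))) ⟩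
        CC ∎
        where
        pair : ∀ i {x y} → x ≤ q i → y ≤ L i → x + y ≤ C i
        pair i {x} {y} x≤o y≤L = begin
          x + y              ≤⟨ +-mono-≤ x≤o y≤L ⟩
          q i + L i    ≈⟨ +-comm (q i) (L i) ⟩
          L i + q i    ≈⟨ L+o≈C i ⟩
          C i                ∎

-- List scheduling on the least loaded machine.

module ListScheduling {c ℓ₁ ℓ₂} (F : OrderedField c ℓ₁ ℓ₂) where
  open OrderedField F hiding (zero)
  open OrderedFieldProperties F
  open Scheduling F using (Slot; _at_; machine; start)

  -- Every decision in sorting and placing is the Boolean of a comparison. Non-anticipation supplies
  -- processing times that agree only up to `_≈_`, and this makes the order and the machines agree
  -- up to `_≡_`.
  ≤?-cong : ∀ {w x y z} → w ≈ x → y ≈ z → does (w ≤? y) ≡ does (x ≤? z)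
  ≤?-cong {w} {x} {y} {z} w≈x y≈z with w ≤? y | x ≤? z
  ... | yes _   | yes _   = ≡.refl
  ... | no  _   | no  _   = ≡.refl
  ... | yes w≤y | no  x≰z = contradiction (begin x ≈⟨ w≈x ⟨ w ≤⟨ w≤y ⟩ y ≈⟨ y≈z ⟩ z ∎) x≰z
  ... | no  w≰y | yes x≤z = contradiction (begin w ≈⟨ w≈x ⟩ x ≤⟨ x≤z ⟩ z ≈⟨ y≈z ⟨ y ∎) w≰y

  argmin : ∀ {m} → (Fin (suc m) → Carrier) → Fin (suc m)
  argmin {zero}  L = zero
  argmin {suc m} L = if does (L zero ≤? L k) then zero else k
    where k = suc (argmin (L ∘ suc))

  argmin-minimal : ∀ {m} (L : Fin (suc m) → Carrier) k → L (argmin L) ≤ L k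
  argmin-minimal {zero}  L zero = ≤-refl
  argmin-minimal {suc m} L k with L zero ≤? L (suc (argmin (L ∘ suc))) | k
  ... | yes _   | zero  = ≤-refl
  ... | yes 0≤k | suc k = ≤-trans 0≤k (argmin-minimal (L ∘ suc) k)
  ... | no  0≰k | zero  with total (L zero) (L (suc (argmin (L ∘ suc))))
  ...   | inj₁ 0≤k = contradiction 0≤k 0≰k
  ...   | inj₂ k≤0 = k≤0
  argmin-minimal {suc m} L _ | no  _   | suc k = argmin-minimal (L ∘ suc) k

  argmin-cong : ∀ {m} {L L′ : Fin (suc m) → Carrier} → (∀ k → L k ≈ L′ k) → argmin L ≡ argmin L′
  argmin-cong {zero}  L≈L′ = ≡.refl
  argmin-cong {suc m} {L} {L′} L≈L′
    rewrite argmin-cong (L≈L′ ∘ suc)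
          | ≤?-cong (L≈L′ zero) (L≈L′ (suc (argmin (L′ ∘ suc)))) = ≡.refl

  sum-updateAt : ∀ {m} (L : Fin m → Carrier) k x → sum (updateAt L k (_+ x)) ≈ sum L + x
  sum-updateAt L zero    x = solve 3 (λ l s x → l :+ x :+ s := l :+ s :+ x) refl (L zero) (sum (L ∘ suc)) x
  sum-updateAt L (suc k) x = trans (+-congˡ (sum-updateAt (L ∘ suc) k x)) (sym (+-assoc _ _ x))

  listSum-mono-≤ : ∀ {a} {A : Set a} (xs : List A) {f g : A → Carrier} →
                   (∀ x → f x ≤ g x) → listSum xs f ≤ listSum xs g
  listSum-mono-≤ []       f≤g = ≤-refl
  listSum-mono-≤ (x ∷ xs) f≤g = +-mono-≤ (f≤g x) (listSum-mono-≤ xs f≤g)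

  listSum-distrib-+ : ∀ {a} {A : Set a} (xs : List A) (f g : A → Carrier) →
                      listSum xs (λ x → f x + g x) ≈ listSum xs f + listSum xs g
  listSum-distrib-+ []       f g = sym (+-identityʳ 0#)
  listSum-distrib-+ (x ∷ xs) f g = trans (+-congˡ (listSum-distrib-+ xs f g))
    (solve 4 (λ a b c d → (a :+ b) :+ (c :+ d) := (a :+ c) :+ (b :+ d)) refl (f x) (g x) _ _)

  listSum-↭ : ∀ {a} {A : Set a} {xs ys : List A} (f : A → Carrier) → xs ↭ ys → listSum xs f ≈ listSum ys f
  listSum-↭ f ↭-refl              = refl
  listSum-↭ f (prep x xs↭ys)      = +-congˡ (listSum-↭ f xs↭ys)
  listSum-↭ f (swap x y xs↭ys)    = trans (+-congˡ (+-congˡ (listSum-↭ f xs↭ys)))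
    (solve 3 (λ a b s → a :+ (b :+ s) := b :+ (a :+ s)) refl (f x) (f y) _)
  listSum-↭ f (↭-trans xs↭ys ys↭zs) = trans (listSum-↭ f xs↭ys) (listSum-↭ f ys↭zs)

  -- Sorting by duration and prefix sums.

  module _ {n : ℕ} where

    byKey : (Fin n → Carrier) → DecTotalOrder _ _ _
    byKey = On.decTotalOrder decTotalOrder

    sortBy : (Fin n → Carrier) → List (Fin n)
    sortBy d = InsertionSort.sort (byKey d) (allFin n)

    sort-cong : ∀ {d e : Fin n → Carrier} → (∀ j → d j ≈ e j) → ∀ xs →
                InsertionSort.sort (byKey d) xs ≡ InsertionSort.sort (byKey e) xs
    sort-cong {d} {e} d≈e = go
      where
      insert-cong : ∀ x xs → InsertionSort.insert (byKey d) x xs ≡ InsertionSort.insert (byKey e) x xs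
      insert-cong x []       = ≡.refl
      insert-cong x (y ∷ xs)
        rewrite ≤?-cong (d≈e x) (d≈e y) | insert-cong x xs = ≡.refl

      go : ∀ xs → InsertionSort.sort (byKey d) xs ≡ InsertionSort.sort (byKey e) xs
      go []       = ≡.refl
      go (x ∷ xs) rewrite go xs = insert-cong x (InsertionSort.sort (byKey e) xs)

    sortBy-↭ : ∀ d → sortBy d ↭ allFin n
    sortBy-↭ d = SortingAlgorithm.sort-↭ (InsertionSort.insertionSort (byKey d)) (allFin n)

    ∈-sortBy : ∀ d j → j ∈ sortBy d
    ∈-sortBy d j = ∈-resp-↭ (↭-sym (sortBy-↭ d)) (∈-allFin j)

    sortBy-sorted : ∀ d → AllPairs (λ i j → d i ≤ d j) (sortBy d)
    sortBy-sorted d = Sorted⇒AllPairs (DecTotalOrder.totalOrder (byKey d))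
      (SortingAlgorithm.sort-↗ (InsertionSort.insertionSort (byKey d)) (allFin n))

    listSum-allFin : ∀ {xs} f → xs ↭ allFin n → listSum xs f ≈ sum f
    listSum-allFin f xs↭ = trans (listSum-↭ f xs↭) (reflexive (listSum-tabulate (λ j → j) f))

    -- The work in front of `j`. For `j` absent from the list it is the whole work of the list, in
    -- line with the default of `place`.
    prefix : (Fin n → Carrier) → List (Fin n) → Fin n → Carrier
    prefix d []       j = 0#
    prefix d (x ∷ xs) j = if does (x ≟ j) then 0# else d x + prefix d xs j

    module _ {d : Fin n → Carrier} (d-nonNeg : ∀ j → 0# ≤ d j) where

      prefix-nonNeg : ∀ xs j → 0# ≤ prefix d xs j
      prefix-nonNeg []       j = ≤-refl
      prefix-nonNeg (x ∷ xs) j with does (x ≟ j)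
      ... | true  = ≤-refl
      ... | false = +-nonNeg (d-nonNeg x) (prefix-nonNeg xs j)

      prefix-∷-self : ∀ x xs → prefix d (x ∷ xs) x ≡ 0#
      prefix-∷-self x xs with x ≟ x
      ... | yes _  = ≡.refl
      ... | no x≢x = contradiction ≡.refl x≢x

      prefix-∷ : ∀ x xs j → prefix d (x ∷ xs) j ≤ d x + prefix d xs j
      prefix-∷ x xs j with does (x ≟ j)
      ... | true  = +-nonNeg (d-nonNeg x) (prefix-nonNeg xs j)
      ... | false = ≤-refl

      -- In sorted order the job in front attains the minimum of the pair. So an unordered pair adds
      -- its minimum to one prefix on the left, doubled by `2#`, and to two entries on the right;
      -- the diagonal yields `listSum xs d`.
      listSum-prefix : ∀ {xs} → AllPairs (λ i j → d i ≤ d j) xs →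
        2# * listSum xs (prefix d xs) + listSum xs d ≤ listSum xs (λ j → listSum xs (λ i → d i ⊓ d j))
      listSum-prefix [] = ≤-reflexive (trans (+-identityʳ _) (zeroʳ 2#))
      listSum-prefix (_∷_ {x} {xs} x≤xs xs↗) = begin
        2# * (prefix d (x ∷ xs) x + listSum xs (prefix d (x ∷ xs))) + (d x + D)
          ≤⟨ +-mono-≤ (*-monoʳ-≤ (fromℕ-nonNeg 2) (+-mono-≤ (≤-reflexive (reflexive (prefix-∷-self x xs)))
               (≤-trans (listSum-mono-≤ xs (prefix-∷ x xs)) (≤-reflexive (listSum-distrib-+ xs _ _))))) ≤-refl ⟩
        2# * (0# + (X + P)) + (d x + D)
          ≈⟨ solve 4 (λ P D X dx → con2 :* (con 0 :+ (X :+ P)) :+ (dx :+ D) :=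
               (dx :+ X) :+ (X :+ (con2 :* P :+ D))) refl P D X (d x) ⟩
        (d x + X) + (X + (2# * P + D))
          ≤⟨ +-monoʳ-≤ _ (+-monoʳ-≤ X (listSum-prefix xs↗)) ⟩
        (d x + X) + (X + listSum xs (λ j → listSum xs (λ i → d i ⊓ d j)))
          ≈⟨ +-cong (+-cong (sym (⊓-idem (d x))) (listSum-cong xs (All.map (λ x≤j → sym (x≤y⇒y⊓x≈x x≤j)) x≤xs)))
               (trans (+-congʳ (listSum-cong xs (All.map (λ x≤j → sym (x≤y⇒x⊓y≈x x≤j)) x≤xs)))
                 (sym (listSum-distrib-+ xs (λ j → d x ⊓ d j) _))) ⟩
        (d x ⊓ d x + listSum xs (λ i → d i ⊓ d x)) +
        listSum xs (λ j → d x ⊓ d j + listSum xs (λ i → d i ⊓ d j)) ∎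
        where
        P = listSum xs (prefix d xs)
        D = listSum xs d
        X = listSum xs (λ _ → d x)

      sum-prefix : 2# * sum (prefix d (sortBy d)) + sum d ≤ ∑∑⊓ d d
      sum-prefix = begin
        2# * sum (prefix d xs) + sum d
          ≈⟨ +-cong (*-congˡ (listSum-allFin (prefix d xs) (sortBy-↭ d))) (listSum-allFin d (sortBy-↭ d)) ⟨
        2# * listSum xs (prefix d xs) + listSum xs d
          ≤⟨ listSum-prefix (sortBy-sorted d) ⟩
        listSum xs (λ j → listSum xs (λ i → d i ⊓ d j))
          ≈⟨ listSum-cong xs (All.universal (λ j → listSum-allFin (λ i → d i ⊓ d j) (sortBy-↭ d)) xs) ⟩
        listSum xs (λ j → sum (λ i → d i ⊓ d j))
          ≈⟨ listSum-allFin (λ j → sum (λ i → d i ⊓ d j)) (sortBy-↭ d) ⟩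
        ∑∑⊓ d d ∎
        where xs = sortBy d

  SameSlot : ∀ {m} → Slot m → Slot m → Set _
  SameSlot a b = machine a ≡ machine b × start a ≈ start b

  -- Greedy placement: starting times, loads and disjointness.

  module _ {n m : ℕ} where

    Loads : Set c
    Loads = Fin (suc m) → Carrier

    step : (Fin n → Carrier) → Loads → Fin n → Loads
    step d L x = updateAt L (argmin L) (_+ d x)

    -- A job absent from the list gets the slot that the next job would get. With this default the
    -- estimates of starting times hold for every job; only the end of a job and disjointness ask
    -- for membership.
    place : (Fin n → Carrier) → Loads → List (Fin n) → Fin n → Slot (suc m)
    place d L []       j = argmin L at L (argmin L)
    place d L (x ∷ xs) j = if does (x ≟ j) then argmin L at L (argmin L) else place d (step d L x) xs j

    loads : (Fin n → Carrier) → Loads → List (Fin n) → Loads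
    loads d L []       = L
    loads d L (x ∷ xs) = loads d (step d L x) xs

    sum-loads : ∀ d L xs → sum (loads d L xs) ≈ sum L + listSum xs d
    sum-loads d L []       = sym (+-identityʳ (sum L))
    sum-loads d L (x ∷ xs) = trans (sum-loads d (step d L x) xs)
      (trans (+-congʳ (sum-updateAt L (argmin L) (d x))) (+-assoc (sum L) (d x) _))

    -- The least load is at most the average load, and the loads at that moment consist of the
    -- initial ones and the work placed before `j`.
    place-average : ∀ d L xs j → fromℕ (suc m) * start (place d L xs j) ≤ sum L + prefix d xs j
    place-average d L xs j = go L xs
      where
      argmin-average : ∀ L → fromℕ (suc m) * L (argmin L) ≤ sum L + 0#
      argmin-average L = begin
        fromℕ (suc m) * L (argmin L)         ≈⟨ sum-const (suc m) (L (argmin L)) ⟨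
        sum {suc m} (λ _ → L (argmin L))     ≤⟨ sum-mono-≤ (argmin-minimal L) ⟩
        sum L                                ≈⟨ +-identityʳ (sum L) ⟨
        sum L + 0#                           ∎

      go : ∀ L xs → fromℕ (suc m) * start (place d L xs j) ≤ sum L + prefix d xs j
      go L [] = argmin-average L
      go L (x ∷ xs) with does (x ≟ j)
      ... | true  = argmin-average L
      ... | false = begin
        fromℕ (suc m) * start (place d (step d L x) xs j)  ≤⟨ go (step d L x) xs ⟩
        sum (step d L x) + prefix d xs j                   ≈⟨ +-congʳ (sum-updateAt L (argmin L) (d x)) ⟩
        sum L + d x + prefix d xs j                        ≈⟨ +-assoc (sum L) (d x) _ ⟩
        sum L + (d x + prefix d xs j)                      ∎

    step-cong : ∀ {d e : Fin n → Carrier} {L L′ : Loads} → (∀ j → d j ≈ e j) → (∀ k → L k ≈ L′ k) →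
                ∀ x k → step d L x k ≈ step e L′ x k
    step-cong {d} {e} {L} {L′} d≈e L≈L′ x k rewrite argmin-cong L≈L′ with k ≟ argmin L′
    ... | yes ≡.refl = begin-equality
      updateAt L k′ (_+ d x) k′   ≡⟨ updateAt-updates k′ L ⟩
      L k′ + d x                  ≈⟨ +-cong (L≈L′ k′) (d≈e x) ⟩
      L′ k′ + e x                 ≡⟨ updateAt-updates k′ L′ ⟨
      updateAt L′ k′ (_+ e x) k′  ∎
      where k′ = argmin L′
    ... | no k≢ = begin-equality
      updateAt L (argmin L′) (_+ d x) k   ≡⟨ updateAt-minimal k (argmin L′) L k≢ ⟩
      L k                                 ≈⟨ L≈L′ k ⟩
      L′ k                                ≡⟨ updateAt-minimal k (argmin L′) L′ k≢ ⟨
      updateAt L′ (argmin L′) (_+ e x) k  ∎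

    place-cong : ∀ {d e : Fin n → Carrier} → (∀ j → d j ≈ e j) →
                 ∀ {L L′ : Loads} → (∀ k → L k ≈ L′ k) → ∀ xs j → SameSlot (place d L xs j) (place e L′ xs j)
    place-cong {d} {e} d≈e {L} {L′} L≈L′ xs j = go L≈L′ xs
      where
      argmin-slot : ∀ {L L′ : Loads} → (∀ k → L k ≈ L′ k) →
                    SameSlot (argmin L at L (argmin L)) (argmin L′ at L′ (argmin L′))
      argmin-slot {L} {L′} L≈L′ rewrite argmin-cong L≈L′ = ≡.refl , L≈L′ (argmin L′)

      go : ∀ {L L′ : Loads} → (∀ k → L k ≈ L′ k) → ∀ xs → SameSlot (place d L xs j) (place e L′ xs j)
      go L≈L′ []       = argmin-slot L≈L′
      go L≈L′ (x ∷ xs) with does (x ≟ j)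
      ... | true  = argmin-slot L≈L′
      ... | false = go (step-cong d≈e L≈L′ x) xs

    module _ {d : Fin n → Carrier} (d-nonNeg : ∀ j → 0# ≤ d j) where

      step-≥ : ∀ L x k → L k ≤ step d L x k
      step-≥ L x k with k ≟ argmin L
      ... | yes ≡.refl = ≤-trans (x+y≥x (d-nonNeg x)) (≤-reflexive (reflexive (≡.sym (updateAt-updates (argmin L) L))))
      ... | no k≢      = ≤-reflexive (reflexive (≡.sym (updateAt-minimal k (argmin L) L k≢)))

      loads-≥ : ∀ L xs k → L k ≤ loads d L xs k
      loads-≥ L []       k = ≤-refl
      loads-≥ L (x ∷ xs) k = ≤-trans (step-≥ L x k) (loads-≥ (step d L x) xs k)

      place-≥ : ∀ L xs j → L (machine (place d L xs j)) ≤ start (place d L xs j)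
      place-≥ L []       j = ≤-refl
      place-≥ L (x ∷ xs) j with does (x ≟ j)
      ... | true  = ≤-refl
      ... | false = ≤-trans (step-≥ L x _) (place-≥ (step d L x) xs j)

      -- The job starts at the least load of its moment, and loads only grow. Applied to the tests,
      -- it shows that a single pause of maximal testing length is enough on all machines at once.
      place-≤-loads : ∀ L xs j k → start (place d L xs j) ≤ loads d L xs k
      place-≤-loads L []       j k = argmin-minimal L k
      place-≤-loads L (x ∷ xs) j k with does (x ≟ j)
      ... | true  = ≤-trans (argmin-minimal L k) (loads-≥ L (x ∷ xs) k)
      ... | false = place-≤-loads (step d L x) xs j k

      place-end : ∀ L {xs j} → j ∈ xs →
                  start (place d L xs j) + d j ≤ loads d L xs (machine (place d L xs j))
      place-end L {x ∷ xs} {j} j∈ with x ≟ j | j∈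
      ... | yes ≡.refl | _          = ≤-trans (≤-reflexive (reflexive (≡.sym (updateAt-updates (argmin L) L))))
                                        (loads-≥ (step d L x) xs (argmin L))
      ... | no x≢j     | here j≡x   = contradiction (≡.sym j≡x) x≢j
      ... | no _       | there j∈xs = place-end (step d L x) j∈xs

      first-ends : ∀ L x xs j → machine (place d (step d L x) xs j) ≡ argmin L →
                   L (argmin L) + d x ≤ start (place d (step d L x) xs j)
      first-ends L x xs j eq = begin
        L (argmin L) + d x                                ≡⟨ updateAt-updates (argmin L) L ⟨
        step d L x (argmin L)                             ≡⟨ ≡.cong (step d L x) eq ⟨
        step d L x (machine (place d (step d L x) xs j))  ≤⟨ place-≥ (step d L x) xs j ⟩
        start (place d (step d L x) xs j)                 ∎

      -- Induction reaches the earlier of the two jobs: it raises the load of its machine to its own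
      -- end, and no later slot on that machine starts below the load.
      place-disjoint : ∀ L {xs i j} → i ∈ xs → j ∈ xs → i ≢ j →
        let a = place d L xs i
            b = place d L xs j
        in machine a ≡ machine b → start a + d i ≤ start b ⊎ start b + d j ≤ start a
      place-disjoint L {x ∷ xs} {i} {j} i∈ j∈ i≢j eq with x ≟ i | x ≟ j | i∈ | j∈
      ... | yes ≡.refl | yes ≡.refl | _ | _ = contradiction ≡.refl i≢j
      ... | yes ≡.refl | no _       | _ | _ = inj₁ (first-ends L x xs j (≡.sym eq))
      ... | no _       | yes ≡.refl | _ | _ = inj₂ (first-ends L x xs i eq)
      ... | no x≢i     | no _       | here i≡x   | _          = contradiction (≡.sym i≡x) x≢i
      ... | no _       | no x≢j     | there _    | here j≡x   = contradiction (≡.sym j≡x) x≢j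
      ... | no _       | no _       | there i∈xs | there j∈xs = place-disjoint (step d L x) i∈xs j∈xs i≢j eq

-- The three-phase online algorithm.

-- Jobs with u j < α t j are run untested, in order of u; then all other jobs
-- are tested; then, after a pause long enough for all tests to finish, the
-- tested jobs are run in order of p.  Every phase goes through all n jobs: those
-- without a task in the phase are given the duration 0 there.
module Algorithm {c ℓ₁ ℓ₂} (F : OrderedField c ℓ₁ ℓ₂) (m : ℕ) (α : OrderedField.Carrier F) where
  open OrderedField F hiding (zero)
  open OrderedFieldProperties F
  open Scheduling F
  open ListScheduling F
  open LowerBound F using (completion-untested; completion-tested)

  maximum : ∀ {n} → (Fin n → Carrier) → Carrier
  maximum = Vector.foldr _⊔_ 0#

  ≤maximum : ∀ {n} (f : Fin n → Carrier) j → f j ≤ maximum f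
  ≤maximum f zero    = x≤x⊔y (f zero) _
  ≤maximum f (suc j) = ≤-trans (≤maximum (f ∘ suc) j) (x≤y⊔x (f zero) _)

  maximum≤ : ∀ {n} (f : Fin n → Carrier) {b} → 0# ≤ b → (∀ j → f j ≤ b) → maximum f ≤ b
  maximum≤ {zero}  f 0≤b f≤b = 0≤b
  maximum≤ {suc n} f 0≤b f≤b = ⊔-lub (f≤b zero) (maximum≤ (f ∘ suc) 0≤b (f≤b ∘ suc))

  module _ {n} (I : Instance n) where
    open Instance I
    open Realisation using (p; p-nonNeg)

    tests : Fin n → Bool
    tests j = does (α * t j ≤? u j)

    w₁ w₂ : Fin n → Carrier
    w₁ j = if tests j then 0# else u j
    w₂ j = if tests j then t j else 0#

    w₃ : (Fin n → Carrier) → Fin n → Carrier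
    w₃ x j = if tests j then x j else 0#

    if-nonNeg : ∀ b {x y} → 0# ≤ x → 0# ≤ y → 0# ≤ (if b then x else y)
    if-nonNeg true  0≤x 0≤y = 0≤x
    if-nonNeg false 0≤x 0≤y = 0≤y

    w₁-nonNeg : ∀ j → 0# ≤ w₁ j
    w₁-nonNeg j = if-nonNeg (tests j) ≤-refl (u-nonNeg j)

    w₂-nonNeg : ∀ j → 0# ≤ w₂ j
    w₂-nonNeg j = if-nonNeg (tests j) (proj₁ (t-pos j)) ≤-refl

    w₃-nonNeg : ∀ (P : Realisation I) j → 0# ≤ w₃ (p P) j
    w₃-nonNeg P j = if-nonNeg (tests j) (p-nonNeg P j) ≤-refl

    -- Feasibility is demanded on every instance, hence the maximum; under uniform testing times it
    -- equals each `t j`.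
    pause : Carrier
    pause = maximum t

    L₀ L₁ L₂ L₃ : Loads {n} {m}
    L₀ _ = 0#
    L₁   = loads w₁ L₀ (sortBy w₁)
    L₂   = loads w₂ L₁ (allFin n)
    L₃ k = L₂ k + pause

    slot₁ slot₂ : Fin n → Slot (suc m)
    slot₁ = place w₁ L₀ (sortBy w₁)
    slot₂ = place w₂ L₁ (allFin n)

    slot₃ : (Fin n → Carrier) → Fin n → Slot (suc m)
    slot₃ x = place (w₃ x) L₃ (sortBy (w₃ x))

    plan : (Fin n → Carrier) → Schedule n (suc m)
    plan x j = if tests j then tested (slot₂ j) (slot₃ x j) else untested (slot₁ j)

    -- Inverts `slot (plan x j) k ≡ just a`, so that feasibility becomes a case distinction on the
    -- phases of two tasks.
    data Placed (x : Fin n → Carrier) (j : Fin n) : Task → Slot (suc m) → Set where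
      full : tests j ≡ false → Placed x j full (slot₁ j)
      test : tests j ≡ true  → Placed x j test (slot₂ j)
      run  : tests j ≡ true  → Placed x j run  (slot₃ x j)

    placed : ∀ x j k {a} → slot (plan x j) k ≡ just a → Placed x j k a
    placed x j k eq with tests j in tj
    placed x j test ≡.refl | true  = test tj
    placed x j run  ≡.refl | true  = run tj
    placed x j full ≡.refl | false = full tj

    slot-placed : ∀ {x j k a} → Placed x j k a → slot (plan x j) k ≡ just a
    slot-placed (full tj) rewrite tj = ≡.refl
    slot-placed (test tj) rewrite tj = ≡.refl
    slot-placed (run tj)  rewrite tj = ≡.refl

    L₀≤L₁ : ∀ k → 0# ≤ L₁ k
    L₀≤L₁ = loads-≥ w₁-nonNeg L₀ (sortBy w₁)

    L₁≤L₂ : ∀ k → L₁ k ≤ L₂ k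
    L₁≤L₂ = loads-≥ w₂-nonNeg L₁ (allFin n)

    pause-nonNeg : 0# ≤ pause
    pause-nonNeg = 0≤maximum t
      where
      0≤maximum : ∀ {n} (f : Fin n → Carrier) → 0# ≤ maximum f
      0≤maximum {zero}  f = ≤-refl
      0≤maximum {suc n} f = ≤-trans (0≤maximum (f ∘ suc)) (x≤y⊔x (f zero) _)

    L₂≤L₃ : ∀ k → L₂ k ≤ L₃ k
    L₂≤L₃ k = x+y≥x pause-nonNeg

    L₁≤slot₂ : ∀ j → L₁ (machine (slot₂ j)) ≤ start (slot₂ j)
    L₁≤slot₂ = place-≥ w₂-nonNeg L₁ (allFin n)

    L₃≤slot₃ : ∀ (P : Realisation I) j → let a = slot₃ (p P) j in L₃ (machine a) ≤ start a
    L₃≤slot₃ P = place-≥ (w₃-nonNeg P) L₃ (sortBy (w₃ (p P)))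

    test-end≤L₃ : ∀ j k → start (slot₂ j) + t j ≤ L₃ k
    test-end≤L₃ j k = +-mono-≤ (place-≤-loads w₂-nonNeg L₁ (allFin n) j k) (≤maximum t j)

    untested-w₁ : ∀ {j} → tests j ≡ false → w₁ j ≡ u j
    untested-w₁ tj rewrite tj = ≡.refl

    tested-w₂ : ∀ {j} → tests j ≡ true → w₂ j ≡ t j
    tested-w₂ tj rewrite tj = ≡.refl

    tested-w₃ : ∀ {x j} → tests j ≡ true → w₃ x j ≡ x j
    tested-w₃ tj rewrite tj = ≡.refl

    w₁-end : ∀ {j} → tests j ≡ false → start (slot₁ j) + u j ≤ L₁ (machine (slot₁ j))
    w₁-end {j} tj = ≡.subst (λ d → start (slot₁ j) + d ≤ L₁ (machine (slot₁ j))) (untested-w₁ tj)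
      (place-end w₁-nonNeg L₀ (∈-sortBy w₁ j))

    same-machine : ∀ {x y} (L : Loads {n} {m}) {k l} → k ≡ l → x ≤ L k → L l ≤ y → x ≤ y
    same-machine L ≡.refl = ≤-trans

    w₁-w₂ : ∀ {i j} → tests i ≡ false → machine (slot₁ i) ≡ machine (slot₂ j) →
            start (slot₁ i) + u i ≤ start (slot₂ j)
    w₁-w₂ {j = j} ti eq = same-machine L₁ eq (w₁-end ti) (L₁≤slot₂ j)

    w₁-w₃ : ∀ (P : Realisation I) {i j} → tests i ≡ false → machine (slot₁ i) ≡ machine (slot₃ (p P) j) →
            start (slot₁ i) + u i ≤ start (slot₃ (p P) j)
    w₁-w₃ P {j = j} ti eq = same-machine L₃ eq (≤-trans (w₁-end ti) (≤-trans (L₁≤L₂ _) (L₂≤L₃ _))) (L₃≤slot₃ P j)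

    w₂-w₃ : ∀ (P : Realisation I) i j → start (slot₂ i) + t i ≤ start (slot₃ (p P) j)
    w₂-w₃ P i j = ≤-trans (test-end≤L₃ i _) (L₃≤slot₃ P j)

    same-phase : ∀ {i j : Fin n} (w : Fin n → Carrier) {x y d e} → w i ≡ d → w j ≡ e →
                 x + w i ≤ y ⊎ y + w j ≤ x → x + d ≤ y ⊎ y + e ≤ x
    same-phase w ≡.refl ≡.refl disj = disj

    plan-feasible : ∀ (P : Realisation I) → Feasible I P (plan (p P))
    plan-feasible P = record
      { start-nonNeg    = λ {j} {k} eq → nonNeg (placed x j k eq)
      ; test-before-run = λ {j} eq → test-before-run
          (placed x j test (≡.cong (λ s → slot s test) eq)) (placed x j run (≡.cong (λ s → slot s run) eq))
      ; no-overlap      = λ {i} {j} {k} {l} ne eq eq′ → no-overlap ne (placed x i k eq) (placed x j l eq′)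
      }
      where
      x = p P

      nonNeg : ∀ {j k a} → Placed x j k a → 0# ≤ start a
      nonNeg {j} (full _) = place-≥ w₁-nonNeg L₀ (sortBy w₁) j
      nonNeg {j} (test _) = ≤-trans (L₀≤L₁ _) (L₁≤slot₂ j)
      nonNeg {j} (run _)  = ≤-trans (L₀≤L₁ _) (≤-trans (L₁≤L₂ _) (≤-trans (L₂≤L₃ _) (L₃≤slot₃ P j)))

      test-before-run : ∀ {j a b} → Placed x j test a → Placed x j run b → start a + t j ≤ start b
      test-before-run {j} (test _) (run _) = w₂-w₃ P j j

      no-overlap : ∀ {i j k l a b} → (i , k) ≢ (j , l) → Placed x i k a → Placed x j l b → machine a ≡ machine b →
                   start a + duration I P i k ≤ start b ⊎ start b + duration I P j l ≤ start a
      no-overlap {i} {j} ne (full ti) (full tj) eq = same-phase w₁ (untested-w₁ ti) (untested-w₁ tj)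
        (place-disjoint w₁-nonNeg L₀ (∈-sortBy w₁ i) (∈-sortBy w₁ j) (λ i≡j → ne (≡.cong (_, full) i≡j)) eq)
      no-overlap {i} {j} ne (test ti) (test tj) eq = same-phase w₂ (tested-w₂ ti) (tested-w₂ tj)
        (place-disjoint w₂-nonNeg L₁ (∈-allFin i) (∈-allFin j) (λ i≡j → ne (≡.cong (_, test) i≡j)) eq)
      no-overlap {i} {j} ne (run ti) (run tj) eq = same-phase (w₃ x) (tested-w₃ {x} ti) (tested-w₃ {x} tj)
        (place-disjoint (w₃-nonNeg P) L₃ (∈-sortBy (w₃ x) i) (∈-sortBy (w₃ x) j) (λ i≡j → ne (≡.cong (_, run) i≡j)) eq)
      no-overlap ne (full ti) (test tj) eq = inj₁ (w₁-w₂ ti eq)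
      no-overlap ne (full ti) (run tj)  eq = inj₁ (w₁-w₃ P ti eq)
      no-overlap {i} {j} ne (test ti) (run tj)  eq = inj₁ (w₂-w₃ P i j)
      no-overlap ne (test ti) (full tj) eq = inj₂ (w₁-w₂ tj (≡.sym eq))
      no-overlap ne (run ti)  (full tj) eq = inj₂ (w₁-w₃ P tj (≡.sym eq))
      no-overlap {i} {j} ne (run ti)  (test tj) eq = inj₂ (w₂-w₃ P j i)

    -- All tests are finished before the first run starts.
    transfer : ∀ (P P′ : Realisation I) τ → (∀ j → TestFinishedBy I τ (plan (p P)) j → p P j ≈ p P′ j) →
               ∀ {j k a} → start a ≤ τ → Starts (plan (p P)) j k a → Starts (plan (p P′)) j k a
    transfer P P′ τ agree {j} {k} {a} a≤τ (b , eq , b≡a , b≈a) with placed (p P) j k eq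
    ... | full tj = b , slot-placed {p P′} (full tj) , b≡a , b≈a
    ... | test tj = b , slot-placed {p P′} (test tj) , b≡a , b≈a
    ... | run tj  = slot₃ (p P′) j , slot-placed {p P′} (run tj) ,
      ≡.trans (≡.sym (proj₁ same)) b≡a , trans (sym (proj₂ same)) b≈a
      where
      w₃≈ : ∀ i → w₃ (p P) i ≈ w₃ (p P′) i
      w₃≈ i with tests i in ti
      ... | false = refl
      ... | true  = agree i (slot₂ i , slot-placed {p P} (test ti) ,
        ≤-trans (w₂-w₃ P i j) (≤-trans (≤-reflexive b≈a) a≤τ))

      same : SameSlot (slot₃ (p P) j) (slot₃ (p P′) j)
      same = ≡.subst (λ xs → SameSlot (slot₃ (p P) j) (place (w₃ (p P′)) L₃ xs j))
        (sort-cong {d = w₃ (p P)} {w₃ (p P′)} w₃≈ (allFin n)) (place-cong {d = w₃ (p P)} {w₃ (p P′)} w₃≈ {L₃} {L₃} (λ _ → refl) (sortBy (w₃ (p P))) j)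

    plan-nonAnticipating : ∀ (P P′ : Realisation I) τ → (∀ j → TestFinishedBy I τ (plan (p P)) j → p P j ≈ p P′ j) →
                           AgreeUpTo τ (plan (p P)) (plan (p P′))
    plan-nonAnticipating P P′ τ agree j k a a≤τ =
      mk⇔ (transfer P P′ τ agree {j} {k} {a} a≤τ) (transfer P′ P τ agree′ {j} {k} {a} a≤τ)
      where
      -- Which jobs are tested, and in which slots, is independent of the realisation, so the
      -- hypothesis is symmetric in `P` and `P′`.
      agree′ : ∀ j → TestFinishedBy I τ (plan (p P′)) j → p P′ j ≈ p P j
      agree′ j (a , eq , a≤τ) with placed (p P′) j test eq
      ... | test tj = sym (agree j (a , slot-placed {p P} (test tj) , a≤τ))

  algorithm : OnlineAlgorithm (suc m)
  algorithm = record
    { schedule        = λ I P → plan I (Realisation.p P)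
    ; feasible        = plan-feasible
    ; nonAnticipating = plan-nonAnticipating
    }

-- Upper bound on the cost of the algorithm under uniform testing times.

module Competitiveness {c ℓ₁ ℓ₂} (F : OrderedField c ℓ₁ ℓ₂) (m : ℕ) (α : OrderedField.Carrier F)
                       {n} (I : Scheduling.Instance F n) (P : Scheduling.Realisation F I)
                       (uniform : Scheduling.UniformTests F I) where
  open OrderedField F hiding (zero)
  open OrderedFieldProperties F
  open Scheduling F
  open ListScheduling F
  open LowerBound F
  open Algorithm F m α
  open Instance I
  open Realisation P

  k : Carrier
  k = fromℕ (suc m)

  0≤k : 0# ≤ k
  0≤k = fromℕ-nonNeg (suc m)

  A : Schedule n (suc m)
  A = plan I p

  v₁ v₂ v₃ work q pre₁ pre₃ : Fin n → Carrier
  v₁     = w₁ I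
  v₂     = w₂ I
  v₃     = w₃ I p
  work j = v₁ j + v₂ j + v₃ j
  q      = optTime I P
  pre₁   = prefix v₁ (sortBy v₁)
  pre₃   = prefix v₃ (sortBy v₃)

  -- The time by which the untested execution or the test of i may delay j.
  delay : Fin n → Fin n → Carrier
  delay i j = if tests I j then v₁ i + v₂ i else 0#

  if-true : ∀ {b} {x y : Carrier} → b ≡ true → (if b then x else y) ≡ x
  if-true ≡.refl = ≡.refl

  if-false : ∀ {b} {x y : Carrier} → b ≡ false → (if b then x else y) ≡ y
  if-false ≡.refl = ≡.refl

  -- The average bound for the phase in which `j` is executed. A tested job waits for all of the
  -- first two phases, which is the sum of the delays including its own test, and for the pause; by
  -- uniformity the pause is at most `t j` and is charged to `work j` in place of the test.
  completion-bound : ∀ j → k * completion I P A j ≤ pre₁ j + pre₃ j + sum (λ i → delay i j) + k * work j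
  completion-bound j = by-cases (tests I j) ≡.refl
    where
    by-cases : ∀ b → tests I j ≡ b → k * completion I P A j ≤ pre₁ j + pre₃ j + sum (λ i → delay i j) + k * work j
    by-cases false tj = begin
      k * completion I P A j                  ≡⟨ ≡.cong (k *_) (completion-untested I P A j plan≡) ⟩
      k * (start (slot₁ I j) + u j)           ≈⟨ distribˡ k _ (u j) ⟩
      k * start (slot₁ I j) + k * u j         ≤⟨ +-mono-≤ (place-average v₁ (L₀ I) (sortBy v₁) j) ≤-refl ⟩
      sum (L₀ I) + pre₁ j + k * u j           ≈⟨ +-congʳ (+-congʳ (trans (sum-const (suc m) 0#) (zeroʳ k))) ⟩
      0# + pre₁ j + k * u j                   ≈⟨ solve 3 (λ x k u → con 0 :+ x :+ k :* u :=
                                                   x :+ con 0 :+ con 0 :+ k :* (u :+ con 0 :+ con 0)) refl (pre₁ j) k (u j) ⟩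
      pre₁ j + 0# + 0# + k * (u j + 0# + 0#)  ≤⟨ +-mono-≤
                                                   (+-mono-≤ (+-monoʳ-≤ (pre₁ j) (prefix-nonNeg (w₃-nonNeg I P) (sortBy v₃) j)) (sum-nonNeg delay-nonNeg))
                                                   (≤-reflexive (*-congˡ (reflexive (≡.sym work≡)))) ⟩
      pre₁ j + pre₃ j + sum (λ i → delay i j) + k * work j ∎
      where
      plan≡ : A j ≡ untested (slot₁ I j)
      plan≡ rewrite tj = ≡.refl

      work≡ : work j ≡ u j + 0# + 0#
      work≡ = ≡.cong₂ _+_ (≡.cong₂ _+_ (if-false tj) (if-false tj)) (if-false tj)

      delay-nonNeg : ∀ i → 0# ≤ delay i j
      delay-nonNeg i = ≤-reflexive (reflexive (≡.sym (if-false tj)))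
    by-cases true tj = begin
      k * completion I P A j                  ≡⟨ ≡.cong (k *_) (completion-tested I P A j plan≡) ⟩
      k * (start (slot₃ I p j) + p j)         ≈⟨ distribˡ k _ (p j) ⟩
      k * start (slot₃ I p j) + k * p j       ≤⟨ +-mono-≤ (place-average v₃ (L₃ I) (sortBy v₃) j) ≤-refl ⟩
      sum (L₃ I) + pre₃ j + k * p j           ≤⟨ +-mono-≤ (+-mono-≤ sum-L₃ ≤-refl) ≤-refl ⟩
      (sum v₁ + sum v₂ + k * t j) + pre₃ j + k * p j
                                              ≈⟨ solve 6 (λ a b k t x p → (a :+ b :+ k :* t) :+ x :+ k :* p :=
                                                   con 0 :+ x :+ (a :+ b) :+ k :* (con 0 :+ t :+ p))
                                                   refl (sum v₁) (sum v₂) k (t j) (pre₃ j) (p j) ⟩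
      0# + pre₃ j + (sum v₁ + sum v₂) + k * (0# + t j + p j)
                                              ≤⟨ +-mono-≤
                                                   (+-mono-≤ (+-mono-≤ (prefix-nonNeg (w₁-nonNeg I) (sortBy v₁) j) ≤-refl) (≤-reflexive sum-delay))
                                                   (≤-reflexive (*-congˡ (reflexive (≡.sym work≡)))) ⟩
      pre₁ j + pre₃ j + sum (λ i → delay i j) + k * work j ∎
      where
      plan≡ : A j ≡ tested (slot₂ I j) (slot₃ I p j)
      plan≡ rewrite tj = ≡.refl

      work≡ : work j ≡ 0# + t j + p j
      work≡ = ≡.cong₂ _+_ (≡.cong₂ _+_ (if-true tj) (if-true tj)) (if-true tj)

      sum-delay : sum v₁ + sum v₂ ≈ sum (λ i → delay i j)
      sum-delay = trans (sym (∑-distrib-+ v₁ v₂)) (sum-cong-≋ {n} (λ i → reflexive (≡.sym (if-true tj))))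

      sum-L₃ : sum (L₃ I) ≤ sum v₁ + sum v₂ + k * t j
      sum-L₃ = begin
        sum (L₃ I)
          ≈⟨ ∑-distrib-+ (L₂ I) (λ _ → pause I) ⟩
        sum (L₂ I) + sum {suc m} (λ _ → pause I)
          ≈⟨ +-cong (sum-loads v₂ (L₁ I) (allFin n)) (sum-const (suc m) (pause I)) ⟩
        (sum (L₁ I) + listSum (allFin n) v₂) + k * pause I
          ≈⟨ +-congʳ (+-cong (sum-loads v₁ (L₀ I) (sortBy v₁)) (reflexive (listSum-tabulate (λ i → i) v₂))) ⟩
        (sum (L₀ I) + listSum (sortBy v₁) v₁ + sum v₂) + k * pause I
          ≈⟨ +-congʳ (+-congʳ (+-cong (trans (sum-const (suc m) 0#) (zeroʳ k)) (listSum-allFin v₁ (sortBy-↭ v₁)))) ⟩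
        (0# + sum v₁ + sum v₂) + k * pause I
          ≤⟨ +-mono-≤ (≤-reflexive (+-congʳ (+-identityˡ (sum v₁))))
               (*-monoʳ-≤ 0≤k (maximum≤ t (proj₁ (t-pos j)) (λ i → ≤-reflexive (uniform i j)))) ⟩
        sum v₁ + sum v₂ + k * t j ∎

  M₁ M₃ H : Carrier
  M₁ = ∑∑⊓ v₁ v₁
  M₃ = ∑∑⊓ v₃ v₃
  H  = sum (λ j → sum (λ i → delay i j + delay j i))

  sum-work : sum work ≈ sum v₁ + sum v₂ + sum v₃
  sum-work = trans (∑-distrib-+ (λ j → v₁ j + v₂ j) v₃) (+-congʳ (∑-distrib-+ v₁ v₂))

  -- Doubling turns the prefix sums of the two sorted phases into sums of pairwise minima, with
  -- `sum v₁ + sum v₃` to spare, and turns the delays into the symmetric sum `H`, fit for comparison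
  -- pair by pair.
  cost-upperBound : 2# * (k * cost I P A) + (sum v₁ + sum v₃) ≤ M₁ + M₃ + H + 2# * (k * (sum v₁ + sum v₂ + sum v₃))
  cost-upperBound = begin
    2# * (k * cost I P A) + (sum v₁ + sum v₃)
      ≈⟨ +-congʳ (*-congˡ (*-distribˡ-sum k (completion I P A))) ⟩
    2# * sum (λ j → k * completion I P A j) + (sum v₁ + sum v₃)
      ≤⟨ +-mono-≤ (*-monoʳ-≤ (fromℕ-nonNeg 2) (sum-mono-≤ completion-bound)) ≤-refl ⟩
    2# * sum (λ j → pre₁ j + pre₃ j + sum (λ i → delay i j) + k * work j) + (sum v₁ + sum v₃)
      ≈⟨ +-congʳ (*-congˡ (trans (∑-distrib-+ (λ j → pre₁ j + pre₃ j + sum (λ i → delay i j)) (λ j → k * work j))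
           (+-cong (trans (∑-distrib-+ (λ j → pre₁ j + pre₃ j) (λ j → sum (λ i → delay i j))) (+-congʳ (∑-distrib-+ pre₁ pre₃)))
             (sym (*-distribˡ-sum k work))))) ⟩
    2# * (sum pre₁ + sum pre₃ + H₁ + k * sum work) + (sum v₁ + sum v₃)
      ≈⟨ solve 6 (λ a b h d v w → con2 :* (a :+ b :+ h :+ d) :+ (v :+ w) :=
           (con2 :* a :+ v) :+ (con2 :* b :+ w) :+ (h :+ h) :+ con2 :* d)
           refl (sum pre₁) (sum pre₃) H₁ (k * sum work) (sum v₁) (sum v₃) ⟩
    (2# * sum pre₁ + sum v₁) + (2# * sum pre₃ + sum v₃) + (H₁ + H₁) + 2# * (k * sum work)
      ≤⟨ +-mono-≤ (+-mono-≤ (+-mono-≤ (sum-prefix (w₁-nonNeg I)) (sum-prefix (w₃-nonNeg I P))) (≤-reflexive H₁+H₁)) ≤-refl ⟩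
    M₁ + M₃ + H + 2# * (k * sum work)
      ≈⟨ +-congˡ (*-congˡ (*-congˡ sum-work)) ⟩
    M₁ + M₃ + H + 2# * (k * (sum v₁ + sum v₂ + sum v₃)) ∎
    where
    H₁ = sum (λ j → sum (λ i → delay i j))

    H₁+H₁ : H₁ + H₁ ≈ H
    H₁+H₁ = begin-equality
      H₁ + H₁
        ≈⟨ +-congˡ (∑-comm (λ j i → delay i j)) ⟩
      H₁ + sum (λ i → sum (λ j → delay i j))
        ≈⟨ ∑-distrib-+ (λ j → sum (λ i → delay i j)) (λ j → sum (λ i → delay j i)) ⟨
      sum (λ j → sum (λ i → delay i j) + sum (λ i → delay j i))
        ≈⟨ sum-cong-≋ (λ j → ∑-distrib-+ (λ i → delay i j) (λ i → delay j i)) ⟨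
      H ∎

  module _ (1≤α : 1# ≤ α) where

    private
      0≤α : 0# ≤ α
      0≤α = 1≤x⇒0≤x 1≤α

    tested⇒αt≤u : ∀ {j} → tests I j ≡ true → α * t j ≤ u j
    tested⇒αt≤u {j} eq with α * t j ≤? u j
    ... | yes αt≤u = αt≤u

    untested⇒u≤αt : ∀ {j} → tests I j ≡ false → u j ≤ α * t j
    untested⇒u≤αt {j} eq with α * t j ≤? u j | total (u j) (α * t j)
    ... | no _     | inj₁ u≤αt = u≤αt
    ... | no αt≰u  | inj₂ αt≤u = contradiction αt≤u αt≰u

    t≤t+p : ∀ j → t j ≤ t j + p j
    t≤t+p j = x+y≥x (p-nonNeg j)

    t+p-nonNeg : ∀ j → 0# ≤ t j + p j
    t+p-nonNeg j = ≤-trans (proj₁ (t-pos j)) (t≤t+p j)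

    untested-ratio : ∀ {ρ j} → α ≤ ρ → tests I j ≡ false → u j ≤ ρ * q j
    untested-ratio {ρ} {j} α≤ρ tj = ⊓-selects (λ x → u j ≤ ρ * x)
      (1≤x⇒y≤xy (≤-trans 1≤α α≤ρ) (u-nonNeg j))
      (begin
        u j                ≤⟨ untested⇒u≤αt tj ⟩
        α * t j            ≤⟨ *-monoʳ-≤ 0≤α (t≤t+p j) ⟩
        α * (t j + p j)    ≤⟨ *-monoˡ-≤ (t+p-nonNeg j) α≤ρ ⟩
        ρ * (t j + p j)    ∎)

    -- Against `t + p` the factor `s` is enough. Against `u`, the threshold `α * t j ≤ u j` turns
    -- `s * t j` into `s / α * u j`, and `p j ≤ u j` adds 1. It is used with `s` equal to 1 for `r`
    -- and equal to 2 for `R`.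
    tested-ratio : ∀ {ρ j} s → 1# ≤ s → s ≤ ρ → 1# + s / α ≤ ρ → tests I j ≡ true → s * t j + p j ≤ ρ * q j
    tested-ratio {ρ} {j} s 1≤s s≤ρ 1+s/α≤ρ tj = ⊓-selects (λ x → s * t j + p j ≤ ρ * x)
      (begin
        s * t j + p j         ≤⟨ +-mono-≤ st≤[s/α]u (p≤u j) ⟩
        s / α * u j + u j     ≈⟨ solve 2 (λ x u → x :* u :+ u := (con 1 :+ x) :* u) refl (s / α) (u j) ⟩
        (1# + s / α) * u j    ≤⟨ *-monoˡ-≤ (u-nonNeg j) 1+s/α≤ρ ⟩
        ρ * u j               ∎)
      (begin
        s * t j + p j         ≤⟨ +-monoʳ-≤ (s * t j) (1≤x⇒y≤xy 1≤s (p-nonNeg j)) ⟩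
        s * t j + s * p j     ≈⟨ distribˡ s (t j) (p j) ⟨
        s * (t j + p j)       ≤⟨ *-monoˡ-≤ (t+p-nonNeg j) s≤ρ ⟩
        ρ * (t j + p j)       ∎)
      where
      st≤[s/α]u : s * t j ≤ s / α * u j
      st≤[s/α]u = *-cancelˡ-≤ 0≤α (1≤x⇒x≉0 1≤α) (begin
        α * (s * t j)            ≈⟨ solve 3 (λ a s t → a :* (s :* t) := s :* (a :* t)) refl α s (t j) ⟩
        s * (α * t j)            ≤⟨ *-monoʳ-≤ (1≤x⇒0≤x 1≤s) (tested⇒αt≤u tj) ⟩
        s * u j                  ≈⟨ *-identityˡ (s * u j) ⟨
        1# * (s * u j)           ≈⟨ *-congʳ (*-inverseʳ (1≤x⇒x≉0 1≤α)) ⟨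
        α * α ⁻¹ * (s * u j)     ≈⟨ solve 4 (λ a b s u → a :* b :* (s :* u) := a :* (s :* b :* u)) refl α (α ⁻¹) s (u j) ⟩
        α * (s / α * u j)        ∎)

    work-ratio : ∀ {r} → α ≤ r → 1# + 1# / α ≤ r → ∀ j → work j ≤ r * q j
    work-ratio {r} α≤r 1+1/α≤r j with tests I j in tj
    ... | false = ≤-trans (≤-reflexive (trans (+-identityʳ _) (+-identityʳ _))) (untested-ratio α≤r tj)
    ... | true  = begin
      0# + t j + p j    ≈⟨ +-congʳ (trans (+-identityˡ (t j)) (sym (*-identityˡ (t j)))) ⟩
      1# * t j + p j    ≤⟨ tested-ratio 1# ≤-refl (≤-trans 1≤α α≤r) 1+1/α≤r tj ⟩
      r * q j           ∎

    module _ {R} (2≤R : 2# ≤ R) (α≤R : α ≤ R) (1+2/α≤R : 1# + 2# / α ≤ R) where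

      private
        0≤R : 0# ≤ R
        0≤R = ≤-trans 0≤α α≤R

        2t+p≤Rq : ∀ {j} → tests I j ≡ true → 2# * t j + p j ≤ R * q j
        2t+p≤Rq tj = tested-ratio 2# (x+y≥x (fromℕ-nonNeg 1)) 2≤R 1+2/α≤R tj

      -- One of the `suc m` copies of `2# * work j`, reduced by the `v₁ j + v₃ j` that
      -- `cost-upperBound` has to spare. This copy is charged to `R`, the other `m` to `r`.
      own-ratio : ∀ j → v₁ j + 2# * v₂ j + v₃ j ≤ R * q j
      own-ratio j with tests I j in tj
      ... | false = ≤-trans (≤-reflexive (trans (+-identityʳ _) (trans (+-congˡ (zeroʳ 2#)) (+-identityʳ _)))) (untested-ratio α≤R tj)
      ... | true  = ≤-trans (≤-reflexive (+-congʳ (+-identityˡ _))) (2t+p≤Rq tj)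

      -- Uniformity makes `α * t j` a common threshold: `u i` is at most this, and both `u j` and
      -- `R * (t j + p j)` are at least this.
      mixed-ratio : ∀ {i j} → tests I i ≡ false → tests I j ≡ true → u i ≤ R * (q i ⊓ q j)
      mixed-ratio {i} {j} ti tj = ⊓-selects (λ x → u i ≤ R * x) (untested-ratio α≤R ti)
        (⊓-selects (λ x → u i ≤ R * x)
          (≤-trans u≤αt (≤-trans (tested⇒αt≤u tj) (1≤x⇒y≤xy (≤-trans 1≤α α≤R) (u-nonNeg j))))
          (≤-trans u≤αt (≤-trans (*-monoʳ-≤ 0≤α (t≤t+p j)) (*-monoˡ-≤ (t+p-nonNeg j) α≤R))))
        where
        u≤αt : u i ≤ α * t j
        u≤αt = ≤-trans (untested⇒u≤αt ti) (≤-reflexive (*-congˡ (uniform i j)))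

      -- Two untested jobs interact by the smaller `u`; in a mixed pair only the untested job delays
      -- the other; two tested jobs interact by both tests and the smaller `p`. The diagonal `i = j`
      -- is included and absorbs a job's own test among its delays.
      pair-ratio : ∀ i j → v₁ i ⊓ v₁ j + v₃ i ⊓ v₃ j + (delay i j + delay j i) ≤ R * (q i ⊓ q j)
      pair-ratio i j with tests I i in ti | tests I j in tj
      ... | false | false = begin
        u i ⊓ u j + 0# ⊓ 0# + (0# + 0#)  ≈⟨ +-cong (+-congˡ (⊓-idem 0#)) (+-identityʳ 0#) ⟩
        u i ⊓ u j + 0# + 0#              ≈⟨ trans (+-identityʳ _) (+-identityʳ _) ⟩
        u i ⊓ u j                        ≤⟨ ⊓-selects (λ x → u i ⊓ u j ≤ R * x)
                                              (≤-trans (x⊓y≤x (u i) (u j)) (untested-ratio α≤R ti))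
                                              (≤-trans (x⊓y≤y (u i) (u j)) (untested-ratio α≤R tj)) ⟩
        R * (q i ⊓ q j)                  ∎
      ... | false | true  = begin
        u i ⊓ 0# + 0# ⊓ p j + (u i + 0# + 0#)  ≤⟨ +-mono-≤ (+-mono-≤ (x⊓y≤y (u i) 0#) (x⊓y≤x 0# (p j))) ≤-refl ⟩
        0# + 0# + (u i + 0# + 0#)              ≈⟨ solve 1 (λ x → con 0 :+ con 0 :+ (x :+ con 0 :+ con 0) := x) refl (u i) ⟩
        u i                                    ≤⟨ mixed-ratio ti tj ⟩
        R * (q i ⊓ q j)                        ∎
      ... | true  | false = begin
        0# ⊓ u j + p i ⊓ 0# + (0# + (u j + 0#))  ≤⟨ +-mono-≤ (+-mono-≤ (x⊓y≤x 0# (u j)) (x⊓y≤y (p i) 0#)) ≤-refl ⟩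
        0# + 0# + (0# + (u j + 0#))              ≈⟨ solve 1 (λ x → con 0 :+ con 0 :+ (con 0 :+ (x :+ con 0)) := x) refl (u j) ⟩
        u j                                      ≤⟨ mixed-ratio tj ti ⟩
        R * (q j ⊓ q i)                          ≈⟨ *-congˡ (⊓-comm (q j) (q i)) ⟩
        R * (q i ⊓ q j)                          ∎
      -- For either job `l`, equal testing times reduce the left side to at most `2# * t l + p l`.
      ... | true  | true  = ⊓-selects (λ x → 0# ⊓ 0# + p i ⊓ p j + (0# + t i + (0# + t j)) ≤ R * x)
        (bound ti (x⊓y≤x (p i) (p j)) refl (uniform j i)) (bound tj (x⊓y≤y (p i) (p j)) (uniform i j) refl)
        where
        bound : ∀ {l} → tests I l ≡ true → p i ⊓ p j ≤ p l → t i ≈ t l → t j ≈ t l →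
                0# ⊓ 0# + p i ⊓ p j + (0# + t i + (0# + t j)) ≤ R * q l
        bound {l} tl p≤ ti≈ tj≈ = begin
          0# ⊓ 0# + p i ⊓ p j + (0# + t i + (0# + t j))
            ≤⟨ +-mono-≤ (+-mono-≤ (≤-reflexive (⊓-idem 0#)) p≤) (≤-reflexive (+-cong (+-congˡ ti≈) (+-congˡ tj≈))) ⟩
          0# + p l + (0# + t l + (0# + t l))
            ≈⟨ solve 2 (λ t p → con 0 :+ p :+ (con 0 :+ t :+ (con 0 :+ t)) := con2 :* t :+ p) refl (t l) (p l) ⟩
          2# * t l + p l
            ≤⟨ 2t+p≤Rq tl ⟩
          R * q l ∎

      Q QQ : Carrier
      Q  = sum q
      QQ = ∑∑⊓ q q

      pairs-ratio : M₁ + M₃ + H ≤ R * QQ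
      pairs-ratio = begin
        M₁ + M₃ + H
          ≈⟨ +-congʳ (∑∑-distrib-+ (λ i j → v₁ i ⊓ v₁ j) (λ i j → v₃ i ⊓ v₃ j)) ⟨
        ∑∑ (λ i j → v₁ i ⊓ v₁ j + v₃ i ⊓ v₃ j) + H
          ≈⟨ ∑∑-distrib-+ (λ i j → v₁ i ⊓ v₁ j + v₃ i ⊓ v₃ j) (λ i j → delay i j + delay j i) ⟨
        ∑∑ (λ i j → v₁ i ⊓ v₁ j + v₃ i ⊓ v₃ j + (delay i j + delay j i))
          ≤⟨ sum-mono-≤ (λ j → sum-mono-≤ (λ i → pair-ratio i j)) ⟩
        ∑∑ (λ i j → R * (q i ⊓ q j))
          ≈⟨ sum-cong-≋ (λ j → *-distribˡ-sum R (λ i → q i ⊓ q j)) ⟨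
        sum (λ j → R * sum (λ i → q i ⊓ q j))
          ≈⟨ *-distribˡ-sum R (λ j → sum (λ i → q i ⊓ q j)) ⟨
        R * QQ ∎
        where
        ∑∑ : (Fin n → Fin n → Carrier) → Carrier
        ∑∑ f = sum (λ j → sum (λ i → f i j))

        ∑∑-distrib-+ : ∀ f g → ∑∑ (λ i j → f i j + g i j) ≈ ∑∑ f + ∑∑ g
        ∑∑-distrib-+ f g = trans (sum-cong-≋ (λ j → ∑-distrib-+ (λ i → f i j) (λ i → g i j)))
          (∑-distrib-+ (λ j → sum (λ i → f i j)) (λ j → sum (λ i → g i j)))

      cost-ratio : ∀ {r} → α ≤ r → 1# + 1# / α ≤ r →
                   2# * (k * cost I P A) ≤ R * QQ + R * Q + fromℕ m * (2# * r * Q)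
      cost-ratio {r} α≤r 1+1/α≤r = ≤-from
        (+-mono-≤ cost-upperBound (+-mono-≤ pairs-ratio (+-mono-≤ sum-own (*-monoʳ-≤ (fromℕ-nonNeg m) (*-monoʳ-≤ (fromℕ-nonNeg 2) sum-work≤rQ)))))
        (solve 10 (λ alg a b c M rq m rQ RQ RQQ →
           con2 :* ((con 1 :+ m) :* alg) :+ (M :+ con2 :* ((con 1 :+ m) :* (a :+ b :+ c)) :+ (RQQ :+ (RQ :+ m :* (con2 :* (rq :* rQ))))) :=
           RQQ :+ RQ :+ m :* (con2 :* rq :* rQ) :+ (con2 :* ((con 1 :+ m) :* alg) :+ (a :+ c) :+ (M :+ (a :+ con2 :* b :+ c :+ m :* (con2 :* (a :+ b :+ c))))))
           refl (cost I P A) (sum v₁) (sum v₂) (sum v₃) (M₁ + M₃ + H) r (fromℕ m) Q (R * Q) (R * QQ))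
        where
        sum-own : sum v₁ + 2# * sum v₂ + sum v₃ ≤ R * Q
        sum-own = begin
          sum v₁ + 2# * sum v₂ + sum v₃
            ≈⟨ +-congʳ (+-congˡ (*-distribˡ-sum 2# v₂)) ⟩
          sum v₁ + sum (λ j → 2# * v₂ j) + sum v₃
            ≈⟨ +-congʳ (∑-distrib-+ v₁ (λ j → 2# * v₂ j)) ⟨
          sum (λ j → v₁ j + 2# * v₂ j) + sum v₃
            ≈⟨ ∑-distrib-+ (λ j → v₁ j + 2# * v₂ j) v₃ ⟨
          sum (λ j → v₁ j + 2# * v₂ j + v₃ j)
            ≤⟨ sum-mono-≤ own-ratio ⟩
          sum (λ j → R * q j)
            ≈⟨ *-distribˡ-sum R q ⟨
          R * Q ∎

        sum-work≤rQ : sum v₁ + sum v₂ + sum v₃ ≤ r * Q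
        sum-work≤rQ = ≤-trans (≤-reflexive (sym sum-work)) (≤-trans (sum-mono-≤ (work-ratio α≤r 1+1/α≤r)) (≤-reflexive (sym (*-distribˡ-sum r q))))

-- Combination of the bounds into the competitive ratio.

module Ratio {c ℓ₁ ℓ₂} (F : OrderedField c ℓ₁ ℓ₂) (m : ℕ) where
  open OrderedField F hiding (zero)
  open OrderedFieldProperties F

  -- With `k` machines, `l = k - 1` and `D = 2r - R`, the upper bound equals
  -- `R * (QQ + k * Q) + l * D * Q`. The first term is charged to the bound with `QQ`, the second to
  -- `Q ≤ opt`; the latter takes `D ≥ 0`, that is `R ≤ 2r`. Division by `2k` gives the stated ratio.
  combine : ∀ {R r Q QQ alg opt} → let k = fromℕ (suc m) in
    0# ≤ R → R ≤ 2# * r →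
    2# * (k * alg) ≤ R * QQ + R * Q + fromℕ m * (2# * r * Q) →
    QQ + k * Q ≤ k * (2# * opt) → Q ≤ opt →
    alg ≤ (R * (1# / 2# + 1# / (2# * k)) + r * (1# - 1# / k)) * opt
  combine {R} {r} {Q} {QQ} {alg} {opt} 0≤R R≤2r alg≤ ≤opt Q≤opt =
    *-cancelˡ-≤ (fromℕ-nonNeg (suc m)) (1≤x⇒x≉0 1≤k) (*-cancelˡ-≤ (fromℕ-nonNeg 2) (1≤x⇒x≉0 1≤2) (begin
      2# * (k * alg)
        ≤⟨ alg≤ ⟩
      R * QQ + R * Q + l * (2# * r * Q)
        ≈⟨ +-congˡ (*-congˡ (*-congʳ D+R≈2r)) ⟨
      R * QQ + R * Q + l * ((D + R) * Q)
        ≈⟨ solve 5 (λ R Q QQ l D → R :* QQ :+ R :* Q :+ l :* ((D :+ R) :* Q) :=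
             R :* (QQ :+ (con 1 :+ l) :* Q) :+ l :* D :* Q) refl R Q QQ l D ⟩
      R * (QQ + k * Q) + l * D * Q
        ≤⟨ +-mono-≤ (*-monoʳ-≤ 0≤R ≤opt) (*-monoʳ-≤ (*-nonNeg (fromℕ-nonNeg m) 0≤D) Q≤opt) ⟩
      R * (k * (2# * opt)) + l * D * opt
        ≈⟨ solve 4 (λ R l D o → R :* ((con 1 :+ l) :* (con2 :* o)) :+ l :* D :* o :=
             (R :* ((con 1 :+ l) :* con 1 :+ con 1) :+ (D :+ R) :* l) :* o) refl R l D opt ⟩
      (R * (k * 1# + 1#) + (D + R) * l) * opt
        ≈⟨ *-congʳ (+-cong (*-congˡ (+-cong (*-congˡ (sym 2a≈1)) (sym 2kb≈1))) (*-cong D+R≈2r (sym ks≈l))) ⟩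
      (R * (k * (2# * 2# ⁻¹) + 2# * k * (2# * k) ⁻¹) + 2# * r * (k * s)) * opt
        ≈⟨ solve 8 (λ R r two k a b s o → (R :* (k :* (two :* a) :+ two :* k :* b) :+ two :* r :* (k :* s)) :* o :=
             two :* (k :* ((R :* (con 1 :* a :+ con 1 :* b) :+ r :* s) :* o)))
             refl R r 2# k (2# ⁻¹) ((2# * k) ⁻¹) s opt ⟩
      2# * (k * ((R * (1# / 2# + 1# / (2# * k)) + r * s) * opt)) ∎))
    where
    k = fromℕ (suc m)
    l = fromℕ m
    s = 1# - 1# / k
    D = 2# * r - R

    0≤D : 0# ≤ D
    0≤D = x+z≤y⇒x≤y-z (≤-trans (≤-reflexive (+-identityˡ R)) R≤2r)

    D+R≈2r : D + R ≈ 2# * r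
    D+R≈2r = x-y+y≈x (2# * r) R

    1≤k : 1# ≤ k
    1≤k = 1≤fromℕ m

    1≤2 : 1# ≤ 2#
    1≤2 = 1≤fromℕ 1

    2a≈1 : 2# * 2# ⁻¹ ≈ 1#
    2a≈1 = *-inverseʳ (1≤x⇒x≉0 1≤2)

    2kb≈1 : 2# * k * (2# * k) ⁻¹ ≈ 1#
    2kb≈1 = *-inverseʳ (1≤x⇒x≉0 (≤-trans 1≤k (1≤x⇒y≤xy 1≤2 (fromℕ-nonNeg (suc m)))))

    ks≈l : k * s ≈ l
    ks≈l = +-cancelʳ 1# (k * s) l (begin-equality
      k * s + 1#               ≈⟨ +-congˡ (trans (*-congˡ (*-identityˡ (k ⁻¹))) (*-inverseʳ (1≤x⇒x≉0 1≤k))) ⟨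
      k * s + k * (1# / k)     ≈⟨ distribˡ k s (1# / k) ⟨
      k * (s + 1# / k)         ≈⟨ *-congˡ (x-y+y≈x 1# (1# / k)) ⟩
      k * 1#                   ≈⟨ *-identityʳ k ⟩
      1# + l                   ≈⟨ +-comm 1# l ⟩
      l + 1#                   ∎)

theorem21 : ∀ {c ℓ₁ ℓ₂} (F : OrderedField c ℓ₁ ℓ₂) →
    let open OrderedField F
        open Scheduling F
    in
    (m : ℕ) .{{_ : NonZero m}} (α : Carrier) → 1# ≤ α →
    let R = 2# ⊔ α ⊔ (1# + 2# / α)
        r = α ⊔ (1# + 1# / α)
    in
    R ≤ 2# * r →
    ∃[ A ] CompetitiveOn {m} UniformTests
      (R * (1# / 2# + 1# / (2# * fromℕ m)) + r * (1# - 1# / fromℕ m)) A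
theorem21 F (suc m) α 1≤α R≤2r = algorithm , λ I uniform P S feasible →
  let open Competitiveness F m α I P uniform using (cost-ratio) in
  combine (≤-trans (1≤x⇒0≤x 1≤α) α≤R) R≤2r
    (cost-ratio 1≤α 2≤R α≤R 1+2/α≤R (x≤x⊔y α (1# + 1# / α)) (x≤y⊔x α (1# + 1# / α)))
    (cost-lowerBound I P feasible)
    (sum-optTime≤cost I P feasible)
  where
  open OrderedField F
  open OrderedFieldProperties F
  open LowerBound F
  open Algorithm F m α using (algorithm)
  open Ratio F m

  2≤R : 2# ≤ 2# ⊔ α ⊔ (1# + 2# / α)
  2≤R = ≤-trans (x≤x⊔y 2# α) (x≤x⊔y (2# ⊔ α) _)

  α≤R : α ≤ 2# ⊔ α ⊔ (1# + 2# / α)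
  α≤R = ≤-trans (x≤y⊔x 2# α) (x≤x⊔y (2# ⊔ α) _)

  1+2/α≤R : 1# + 2# / α ≤ 2# ⊔ α ⊔ (1# + 2# / α)
  1+2/α≤R = x≤y⊔x (2# ⊔ α) _
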